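{- Let $p$ be a prime and let $\alpha$ be, locally at $p$, a convolution product in normal form of valence $\langle r,s\rangle$ with $r\ge1$ and $s\ge1$ (a mixed product). Then $\alpha$ is of type 4 at $p$: $\alpha(p^n)\neq0$ for infinitely many $n$, and infinitely many of the parameters $t_j$ of $\alpha$ at $p$ are non-zero.
   Context: A multiplicative arithmetic function is a function $\alpha:\mathbb{N}_{\ge1}\to\mathbb{C}$, not identically zero, with $\alpha(mn)=\alpha(m)\alpha(n)$ whenever $\gcd(m,n)=1$. Dirichlet convolution is $(\alpha*\beta)(n)=\sum_{d\mid n}\alpha(d)\beta(n/d)$. Generalized Fibonacci polynomials: $F_0=1$ and, for $n\ge1$, $F_n(t_1,\dots,t_n)=\sum\binom{a_1+\dots+a_n}{a_1,\dots,a_n}t_1^{a_1}\cdots t_n^{a_n}$, the sum being over tuples of non-negative integers with $\sum_j ja_j=n$. The parameters of $\alpha$ at $p$ are the unique complex numbers $t_1,t_2,\dots$ such that $F_n(t_1,\dots,t_n)=\alpha(p^n)$ for all $n\ge0$. A degree-1 function at $p$ is one with values $p^n\mapsto b^n$ $(n\ge0)$ for some complex $b\ne0$. A product of valence $\langle r,s\rangle$ is a convolution product $\beta_1*\dots*\beta_r*\gamma_1^{ -1}*\dots*\gamma_s^{ -1}$ with all $\beta_i,\gamma_j$ of degree 1 at $p$; it is in normal form if no two factors are mutually inverse, i.e. $\beta_i(p)\ne\gamma_j(p)$ for all $i,j$. -}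

module Defs where

open import Level using (0ℓ)
open import Function.Base using (_∘_; id; case_of_)
open import Data.Empty using (⊥-elim)
open import Data.Bool.Base using (if_then_else_)
open import Data.Fin.Base using (Fin; toℕ)
open import Data.List.Base as List using (List; []; _∷_)
open import Data.Nat.Base as ℕ using (ℕ; zero; suc; NonZero; _!)
import Data.Nat.DivMod as ℕ
open import Data.Nat.Divisibility using (_∣?_)
open import Data.Nat.GCD using (gcd)
import Data.Nat.Properties as ℕ
open import Data.Nat.Properties using (_!≢0)
open import Data.Vec.Base as Vec using (Vec; []; _∷_)
import Data.Vec.Functional as Vector
open import Data.Product.Base using (∃; _×_; _,_; proj₁; proj₂; uncurry)
open import Data.Sum.Base as Sum using (_⊎_; inj₁; inj₂)
import Data.Rational.Base
open import Data.Rational.Base as ℚ using (ℚ; 0ℚ; 1ℚ; ½; ∣_∣)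
import Data.Rational.Properties as ℚ
open import Data.Rational.Solver using (module +-*-Solver)
open import Relation.Binary.PropositionalEquality
  using (_≡_; refl; sym; trans; cong; cong₂; subst; subst₂)
open import Relation.Nullary using (¬_; yes; no)
open import Relation.Binary using (tri<; tri≈; tri>)
import Data.Integer.Base as ℤ
open import Algebra.Apartness using (HeytingField; HeytingCommutativeRing)
open import Algebra.Bundles using (CommutativeRing; Semiring)
open import Algebra.Structures using (IsCommutativeRing)

private
  half : ∀ ε → ½ ℚ.* ε ℚ.+ ½ ℚ.* ε ≡ ε
  half = solve 1 (λ e → con ½ :* e :+ con ½ :* e := e) refl
    where open +-*-Solver

  half-pos : ∀ {ε} → 0ℚ ℚ.< ε → 0ℚ ℚ.< ½ ℚ.* ε
  half-pos {ε} 0<ε = subst (ℚ._< ½ ℚ.* ε) (ℚ.*-zeroʳ ½) (ℚ.*-monoʳ-<-pos ½ 0<ε)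

  *-pos : ∀ {p q} → 0ℚ ℚ.< p → 0ℚ ℚ.< q → 0ℚ ℚ.< p ℚ.* q
  *-pos {p} {q} 0<p 0<q =
    subst (ℚ._< p ℚ.* q) (ℚ.*-zeroʳ p) (ℚ.*-monoʳ-<-pos p {{ℚ.positive 0<p}} 0<q)

  -- The reciprocal, made total by 1/0 = 0.
  inv : ℚ → ℚ
  inv q with q ℚ.≟ 0ℚ
  ... | yes _  = 0ℚ
  ... | no q≢0 = ℚ.1/_ q {{ℚ.≢-nonZero q≢0}}

  inv-* : ∀ {q} → ¬ q ≡ 0ℚ → inv q ℚ.* q ≡ 1ℚ
  inv-* {q} q≢0 with q ℚ.≟ 0ℚ
  ... | yes q≡0 = ⊥-elim (q≢0 q≡0)
  ... | no ne   = ℚ.*-inverseˡ q {{ℚ.≢-nonZero ne}}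

  pos⇒≢0 : ∀ {q} → 0ℚ ℚ.< q → ¬ q ≡ 0ℚ
  pos⇒≢0 0<q q≡0 = ℚ.<-irrefl (sym q≡0) 0<q

  inv-pos : ∀ {q} → 0ℚ ℚ.< q → 0ℚ ℚ.< inv q
  inv-pos {q} 0<q with q ℚ.≟ 0ℚ
  ... | yes q≡0 = ⊥-elim (pos⇒≢0 0<q q≡0)
  ... | no ne   = ℚ.positive⁻¹ _ {{ℚ.1/pos⇒pos q {{ℚ.positive 0<q}}}}

  divide : ∀ {b ε} → 0ℚ ℚ.< b → 0ℚ ℚ.< ε → ∃ λ δ → (0ℚ ℚ.< δ) × (b ℚ.* δ ≡ ε)
  divide {b} {ε} 0<b 0<ε = inv b ℚ.* ε , *-pos (inv-pos 0<b) 0<ε ,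
    trans (sym (ℚ.*-assoc b (inv b) ε))
      (trans (cong (ℚ._* ε) (trans (ℚ.*-comm b (inv b)) (inv-* (pos⇒≢0 0<b))))
             (ℚ.*-identityˡ ε))

  *-mono-≤-nonNeg : ∀ {a b c d} → 0ℚ ℚ.≤ a → 0ℚ ℚ.≤ d → a ℚ.≤ b → c ℚ.≤ d → a ℚ.* c ℚ.≤ b ℚ.* d
  *-mono-≤-nonNeg {a} {b} {c} {d} 0≤a 0≤d a≤b c≤d = ℚ.≤-trans
    (ℚ.*-monoˡ-≤-nonNeg a {{ℚ.nonNegative 0≤a}} c≤d)
    (ℚ.*-monoʳ-≤-nonNeg d {{ℚ.nonNegative 0≤d}} a≤b)

  ∣p∣≤∣p-q∣+∣q∣ : ∀ p q → ∣ p ∣ ℚ.≤ ∣ p ℚ.- q ∣ ℚ.+ ∣ q ∣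
  ∣p∣≤∣p-q∣+∣q∣ p q = subst (λ x → ∣ x ∣ ℚ.≤ ∣ p ℚ.- q ∣ ℚ.+ ∣ q ∣)
    (solve 2 (λ p q → (p :- q) :+ q := p) refl p q)
    (ℚ.∣p+q∣≤∣p∣+∣q∣ (p ℚ.- q) q)
    where open +-*-Solver

  ∣p-q∣≡∣q-p∣ : ∀ p q → ∣ p ℚ.- q ∣ ≡ ∣ q ℚ.- p ∣
  ∣p-q∣≡∣q-p∣ p q = trans (sym (ℚ.∣-p∣≡∣p∣ (p ℚ.- q)))
    (cong ∣_∣ (solve 2 (λ p q → :- (p :- q) := q :- p) refl p q))
    where open +-*-Solver

  +-cancel-< : ∀ p {q r} → p ℚ.+ q ℚ.< p ℚ.+ r → q ℚ.< r
  +-cancel-< p {q} {r} lt = subst₂ ℚ._<_ (e q) (e r) (ℚ.+-monoʳ-< (ℚ.- p) lt)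
    where
    open +-*-Solver
    e : ∀ q → ℚ.- p ℚ.+ (p ℚ.+ q) ≡ q
    e q = solve 2 (λ p q → :- p :+ (p :+ q) := q) refl p q

  module _ {I : Set} (rank : I → ℕ) where

    Eventually : (I → Set) → Set
    Eventually P = ∃ λ N → ∀ i → N ℕ.≤ rank i → P i

    Null : (I → ℚ) → Set
    Null a = ∀ ε → 0ℚ ℚ.< ε → Eventually λ i → ∣ a i ∣ ℚ.< ε

    Bounded : (I → ℚ) → Set
    Bounded a = ∃ λ B → (0ℚ ℚ.< B) × Eventually λ i → ∣ a i ∣ ℚ.< B

    Away : (I → ℚ) → Set
    Away a = ∃ λ ε → (0ℚ ℚ.< ε) × Eventually λ i → ε ℚ.< ∣ a i ∣

  module _ {I : Set} {rank : I → ℕ} where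

    ev-map : {P Q : I → Set} → (∀ i → P i → Q i) → Eventually rank P → Eventually rank Q
    ev-map f (N , p) = N , λ i N≤i → f i (p i N≤i)

    ev-map₂ : {P Q R : I → Set} → (∀ i → P i → Q i → R i) →
              Eventually rank P → Eventually rank Q → Eventually rank R
    ev-map₂ f (M , p) (N , q) = M ℕ.⊔ N , λ i le →
      f i (p i (ℕ.≤-trans (ℕ.m≤m⊔n M N) le)) (q i (ℕ.≤-trans (ℕ.m≤n⊔m M N) le))

    null-cong-ev : ∀ {a b} → Eventually rank (λ i → a i ≡ b i) → Null rank a → Null rank b
    null-cong-ev eq na ε 0<ε = ev-map₂ (λ i e → subst (λ x → ∣ x ∣ ℚ.< ε) e) eq (na ε 0<ε)

    null-cong : ∀ {a b} → (∀ i → a i ≡ b i) → Null rank a → Null rank b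
    null-cong eq = null-cong-ev (0 , λ i _ → eq i)

    null-0 : ∀ {a} → (∀ i → a i ≡ 0ℚ) → Null rank a
    null-0 eq ε 0<ε = 0 , λ i _ → subst (λ x → ∣ x ∣ ℚ.< ε) (sym (eq i)) 0<ε

    null-neg : ∀ {a} → Null rank a → Null rank (λ i → ℚ.- a i)
    null-neg {a} na ε 0<ε = ev-map (λ i → subst (ℚ._< ε) (sym (ℚ.∣-p∣≡∣p∣ (a i)))) (na ε 0<ε)

    null-+ : ∀ {a b} → Null rank a → Null rank b → Null rank (λ i → a i ℚ.+ b i)
    null-+ {a} {b} na nb ε 0<ε = ev-map₂
      (λ i p q → ℚ.≤-<-trans (ℚ.∣p+q∣≤∣p∣+∣q∣ (a i) (b i))
                   (subst (∣ a i ∣ ℚ.+ ∣ b i ∣ ℚ.<_) (half ε) (ℚ.+-mono-< p q)))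
      (na (½ ℚ.* ε) (half-pos 0<ε)) (nb (½ ℚ.* ε) (half-pos 0<ε))

    null-* : ∀ {a b} → Bounded rank a → Null rank b → Null rank (λ i → a i ℚ.* b i)
    null-* {a} {b} (B , 0<B , ba) nb ε 0<ε with divide 0<B 0<ε
    ... | δ , 0<δ , Bδ≡ε = ev-map₂
      (λ i p q → subst₂ ℚ._<_ (sym (ℚ.∣p*q∣≡∣p∣*∣q∣ (a i) (b i))) Bδ≡ε
        (ℚ.≤-<-trans
          (ℚ.*-monoʳ-≤-nonNeg ∣ b i ∣ {{ℚ.∣-∣-nonNeg (b i)}} (ℚ.<⇒≤ p))
          (ℚ.*-monoʳ-<-pos B {{ℚ.positive 0<B}} q)))
      ba (nb δ 0<δ)

    bounded-* : ∀ {a b} → Bounded rank a → Bounded rank b → Bounded rank (λ i → a i ℚ.* b i)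
    bounded-* {a} {b} (B , 0<B , ba) (C , 0<C , bb) = B ℚ.* C , *-pos 0<B 0<C , ev-map₂
      (λ i p q → subst (ℚ._< B ℚ.* C) (sym (ℚ.∣p*q∣≡∣p∣*∣q∣ (a i) (b i)))
        (ℚ.≤-<-trans
          (ℚ.*-monoʳ-≤-nonNeg ∣ b i ∣ {{ℚ.∣-∣-nonNeg (b i)}} (ℚ.<⇒≤ p))
          (ℚ.*-monoʳ-<-pos B {{ℚ.positive 0<B}} q)))
      ba bb

    away⇒≢0 : ∀ {a} → Away rank a → Eventually rank (λ i → ¬ a i ≡ 0ℚ)
    away⇒≢0 (ε , 0<ε , ev) = ev-map
      (λ i lt eq → ℚ.<-asym 0<ε (subst (λ x → ε ℚ.< ∣ x ∣) eq lt)) ev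

    away-inv : ∀ {a} → Away rank a → Bounded rank (inv ∘ a)
    away-inv {a} aw@(ε , 0<ε , ev) = inv ε , inv-pos 0<ε , ev-map₂ bound ev (away⇒≢0 {a} aw)
      where
      bound : ∀ i → ε ℚ.< ∣ a i ∣ → ¬ a i ≡ 0ℚ → ∣ inv (a i) ∣ ℚ.< inv ε
      bound i lt ne = ℚ.*-cancelʳ-<-nonNeg ε {{ℚ.nonNegative (ℚ.<⇒≤ 0<ε)}}
        (subst (∣ inv (a i) ∣ ℚ.* ε ℚ.<_)
          (trans (sym (ℚ.∣p*q∣≡∣p∣*∣q∣ (inv (a i)) (a i)))
            (trans (cong ∣_∣ (inv-* ne)) (sym (inv-* (pos⇒≢0 0<ε)))))
          (ℚ.*-monoʳ-<-pos ∣ inv (a i) ∣ {{ℚ.positive pos}} lt))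
        where
        pos : 0ℚ ℚ.< ∣ inv (a i) ∣
        pos with ℚ.<-cmp 0ℚ ∣ inv (a i) ∣
        ... | tri< p _ _ = p
        ... | tri≈ _ e _ = ⊥-elim (ℚ.<⇒≢ {0ℚ} {1ℚ} (ℚ.*<* (ℤ.+<+ (ℕ.s≤s ℕ.z≤n)))
                (trans (sym (ℚ.*-zeroˡ (a i)))
                  (trans (cong (ℚ._* a i) (sym (ℚ.∣p∣≡0⇒p≡0 _ (sym e)))) (inv-* ne))))
        ... | tri> _ _ p = ⊥-elim (ℚ.<-irrefl refl (ℚ.<-≤-trans p (ℚ.0≤∣p∣ (inv (a i)))))

    away-*ˡ : ∀ {a b} → Bounded rank b → Away rank (λ i → a i ℚ.* b i) → Away rank a
    away-*ˡ {a} {b} (B , 0<B , bb) (ε , 0<ε , ev) with divide 0<B 0<ε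
    ... | δ , 0<δ , Bδ≡ε = δ , 0<δ , ev-map₂
      (λ i p q → ℚ.*-cancelˡ-<-nonNeg B {{ℚ.nonNegative (ℚ.<⇒≤ 0<B)}}
        (subst (ℚ._< B ℚ.* ∣ a i ∣) (sym Bδ≡ε)
          (ℚ.<-≤-trans (subst (ε ℚ.<_) (trans (ℚ.∣p*q∣≡∣p∣*∣q∣ (a i) (b i)) (ℚ.*-comm ∣ a i ∣ ∣ b i ∣)) q)
            (ℚ.*-monoʳ-≤-nonNeg ∣ a i ∣ {{ℚ.∣-∣-nonNeg (a i)}} (ℚ.<⇒≤ p)))))
      bb ev

    away-cong : ∀ {a b} → (∀ i → a i ≡ b i) → Away rank a → Away rank b
    away-cong eq (ε , 0<ε , ev) = ε , 0<ε , ev-map (λ i → subst (λ x → ε ℚ.< ∣ x ∣) (eq i)) ev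

    away-null : ∀ {a b} → Away rank a → Null rank (λ i → a i ℚ.- b i) → Away rank b
    away-null {a} {b} (ε , 0<ε , ev) nu = ½ ℚ.* ε , half-pos 0<ε , ev-map₂
      (λ i p q → +-cancel-< (½ ℚ.* ε) (subst (ℚ._< ½ ℚ.* ε ℚ.+ ∣ b i ∣) (sym (half ε))
        (ℚ.<-≤-trans p (ℚ.≤-trans (∣p∣≤∣p-q∣+∣q∣ (a i) (b i))
          (ℚ.+-monoˡ-≤ ∣ b i ∣ (ℚ.<⇒≤ q))))))
      ev (nu (½ ℚ.* ε) (half-pos 0<ε))

  ∣p∣∣p∣≡pp : ∀ p → ∣ p ∣ ℚ.* ∣ p ∣ ≡ p ℚ.* p
  ∣p∣∣p∣≡pp p with ℚ.∣p∣≡p∨∣p∣≡-p p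
  ... | inj₁ e = cong₂ ℚ._*_ e e
  ... | inj₂ e = trans (cong₂ ℚ._*_ e e) (solve 1 (λ p → (:- p) :* (:- p) := p :* p) refl p)
    where open +-*-Solver

  0≤pp : ∀ p → 0ℚ ℚ.≤ p ℚ.* p
  0≤pp p = subst (0ℚ ℚ.≤_) (trans (ℚ.∣p*q∣≡∣p∣*∣q∣ p p) (∣p∣∣p∣≡pp p)) (ℚ.0≤∣p∣ (p ℚ.* p))

  sum²-bound : ∀ p q {ε} → 0ℚ ℚ.< ε → ε ℚ.< ∣ p ∣ →
               ε ℚ.* ε ℚ.< ∣ (p ℚ.* p ℚ.+ q ℚ.* q) ℚ.- 0ℚ ∣
  sum²-bound p q {ε} 0<ε lt = subst (ε ℚ.* ε ℚ.<_)
    (sym (trans (cong ∣_∣ (ℚ.+-identityʳ (p ℚ.* p ℚ.+ q ℚ.* q))) (ℚ.0≤p⇒∣p∣≡p (ℚ.≤-trans (0≤pp p) le))))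
    (ℚ.<-≤-trans (subst (ε ℚ.* ε ℚ.<_) (∣p∣∣p∣≡pp p)
      (ℚ.<-trans (ℚ.*-monoʳ-<-pos ε {{ℚ.positive 0<ε}} lt)
                 (ℚ.*-monoˡ-<-pos ∣ p ∣ {{ℚ.positive (ℚ.<-trans 0<ε lt)}} lt))) le)
    where
    le : p ℚ.* p ℚ.≤ p ℚ.* p ℚ.+ q ℚ.* q
    le = subst (ℚ._≤ p ℚ.* p ℚ.+ q ℚ.* q) (ℚ.+-identityʳ (p ℚ.* p))
           (ℚ.+-monoʳ-≤ (p ℚ.* p) (0≤pp q))

-- Reals are Cauchy sequences of rationals, each carrying its modulus of
-- convergence; equality is the setoid relation Real._≈_, which ignores moduli.
Cauchy : (ℕ → ℚ) → Set
Cauchy x = ∀ ε → 0ℚ ℚ.< ε →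
  ∃ λ N → ∀ m n → N ℕ.≤ m → N ℕ.≤ n → ∣ x m ℚ.- x n ∣ ℚ.< ε

record ℝ : Set where
  constructor mkℝ
  field
    seq    : ℕ → ℚ
    cauchy : Cauchy seq

open ℝ

module Real where

  infix 4 _≈_ _#_

  record _≈_ (x y : ℝ) : Set where
    constructor close
    field
      null : ∀ ε → 0ℚ ℚ.< ε → ∃ λ N → ∀ n → N ℕ.≤ n → ∣ seq x n ℚ.- seq y n ∣ ℚ.< ε

  -- Apartness, the constructive form of x ≠ y: classically it is just ¬ x ≈ y.
  record _#_ (x y : ℝ) : Set where
    constructor apart
    field
      away : ∃ λ ε → (0ℚ ℚ.< ε) × ∃ λ N → ∀ n → N ℕ.≤ n → ε ℚ.< ∣ seq x n ℚ.- seq y n ∣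

  open _≈_ public
  open _#_ public

  private
    open +-*-Solver

    rank₂ : ℕ × ℕ → ℕ
    rank₂ = uncurry ℕ._⊓_

    Null₂ : (ℕ × ℕ → ℚ) → Set
    Null₂ = Null rank₂

    Δ : (ℕ → ℚ) → ℕ × ℕ → ℚ
    Δ x (m , n) = x m ℚ.- x n

    fromNull : ∀ x → Null₂ (Δ x) → Cauchy x
    fromNull x nu ε 0<ε = case nu ε 0<ε of λ
      (N , f) → N , λ m n N≤m N≤n → f (m , n) (ℕ.⊓-glb N≤m N≤n)

    toNull : ∀ x → Null₂ (Δ (seq x))
    toNull x ε 0<ε with cauchy x ε 0<ε
    ... | N , f = N , λ (m , n) le → f m n (ℕ.m≤n⊓o⇒m≤n m n le) (ℕ.m≤n⊓o⇒m≤o m n le)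

    fst-ev : ∀ {P} → Eventually id P → Eventually rank₂ (P ∘ proj₁)
    fst-ev (N , f) = N , λ (m , n) le → f m (ℕ.m≤n⊓o⇒m≤n m n le)

    snd-ev : ∀ {P} → Eventually id P → Eventually rank₂ (P ∘ proj₂)
    snd-ev (N , f) = N , λ (m , n) le → f n (ℕ.m≤n⊓o⇒m≤o m n le)

    fst-bd : ∀ {a} → Bounded id a → Bounded rank₂ (a ∘ proj₁)
    fst-bd (B , 0<B , ev) = B , 0<B , fst-ev ev

    snd-bd : ∀ {a} → Bounded id a → Bounded rank₂ (a ∘ proj₂)
    snd-bd (B , 0<B , ev) = B , 0<B , snd-ev ev

    0<1 : 0ℚ ℚ.< 1ℚ
    0<1 = ℚ.*<* (ℤ.+<+ (ℕ.s≤s ℕ.z≤n))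

    bounded : ∀ x → Bounded id (seq x)
    bounded x with cauchy x 1ℚ 0<1
    ... | N , f = 1ℚ ℚ.+ ∣ seq x N ∣
                , ℚ.<-≤-trans 0<1 (subst (ℚ._≤ 1ℚ ℚ.+ ∣ seq x N ∣) (ℚ.+-identityʳ 1ℚ)
                                     (ℚ.+-monoʳ-≤ 1ℚ (ℚ.0≤∣p∣ (seq x N))))
                , N , λ n N≤n → ℚ.≤-<-trans (∣p∣≤∣p-q∣+∣q∣ (seq x n) (seq x N))
                                (ℚ.+-monoˡ-< ∣ seq x N ∣ (f n N N≤n ℕ.≤-refl))

  abstract
    const-cauchy : ∀ q → Cauchy (λ _ → q)
    const-cauchy q = fromNull (λ _ → q) (null-0 λ _ → ℚ.+-inverseʳ q)

  0ℝ 1ℝ : ℝ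
  0ℝ = mkℝ (λ _ → 0ℚ) (const-cauchy 0ℚ)
  1ℝ = mkℝ (λ _ → 1ℚ) (const-cauchy 1ℚ)

  abstract
    +-cauchy : ∀ x y → Cauchy (λ n → seq x n ℚ.+ seq y n)
    +-cauchy x y = fromNull (λ n → seq x n ℚ.+ seq y n) (null-cong
      (λ (m , n) → solve 4 (λ a b c d → (a :- b) :+ (c :- d) := (a :+ c) :- (b :+ d)) refl
                     (seq x m) (seq x n) (seq y m) (seq y n))
      (null-+ (toNull x) (toNull y)))

    -‿cauchy : ∀ x → Cauchy (λ n → ℚ.- seq x n)
    -‿cauchy x = fromNull (λ n → ℚ.- seq x n) (null-cong
      (λ (m , n) → solve 2 (λ a b → :- (a :- b) := (:- a) :- (:- b)) refl (seq x m) (seq x n))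
      (null-neg (toNull x)))

    *-cauchy : ∀ x y → Cauchy (λ n → seq x n ℚ.* seq y n)
    *-cauchy x y = fromNull (λ n → seq x n ℚ.* seq y n) (null-cong
      (λ (m , n) → solve 4 (λ a b c d → a :* (c :- d) :+ d :* (a :- b) := a :* c :- b :* d) refl
                     (seq x m) (seq x n) (seq y m) (seq y n))
      (null-+ (null-* (fst-bd (bounded x)) (toNull y))
              (null-* (snd-bd (bounded y)) (toNull x))))

    inv-cauchy : ∀ x → x # 0ℝ → Cauchy (inv ∘ seq x)
    inv-cauchy x x#0 = fromNull (inv ∘ seq x) (null-cong-ev
      (ev-map₂ (λ (m , n) p q → eq (seq x m) (seq x n) p q) (fst-ev ne) (snd-ev ne))
      (null-* (bounded-* (fst-bd bd) (snd-bd bd)) (null-neg (toNull x))))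
      where
      aw : Away id (seq x)
      aw = away-cong {b = seq x} (λ n → ℚ.+-identityʳ (seq x n)) (away x#0)
      ne : Eventually id (λ n → ¬ seq x n ≡ 0ℚ)
      ne = away⇒≢0 {a = seq x} aw
      bd : Bounded id (inv ∘ seq x)
      bd = away-inv {a = seq x} aw
      eq : ∀ a b → ¬ a ≡ 0ℚ → ¬ b ≡ 0ℚ → inv a ℚ.* inv b ℚ.* (ℚ.- (a ℚ.- b)) ≡ inv a ℚ.- inv b
      eq a b a≢0 b≢0 = trans
        (solve 4 (λ a b c d → c :* d :* (:- (a :- b)) := c :* (d :* b) :- d :* (c :* a)) refl
           a b (inv a) (inv b))
        (cong₂ ℚ._-_ (trans (cong (inv a ℚ.*_) (inv-* b≢0)) (ℚ.*-identityʳ (inv a)))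
                     (trans (cong (inv b ℚ.*_) (inv-* a≢0)) (ℚ.*-identityʳ (inv b))))

  infixl 6 _+_ _-_
  infixl 7 _*_
  infix 8 -_

  _+_ : ℝ → ℝ → ℝ
  x + y = mkℝ (λ n → seq x n ℚ.+ seq y n) (+-cauchy x y)

  -_ : ℝ → ℝ
  - x = mkℝ (λ n → ℚ.- seq x n) (-‿cauchy x)

  _*_ : ℝ → ℝ → ℝ
  x * y = mkℝ (λ n → seq x n ℚ.* seq y n) (*-cauchy x y)

  _-_ : ℝ → ℝ → ℝ
  x - y = x + (- y)

  recip : ∀ x → x # 0ℝ → ℝ
  recip x x#0 = mkℝ (inv ∘ seq x) (inv-cauchy x x#0)

  abstract
    pointwise : ∀ {x y} → (∀ n → seq x n ≡ seq y n) → x ≈ y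
    pointwise {x} {y} eq = close (null-0 λ n →
      trans (cong (ℚ._- seq y n) (eq n)) (ℚ.+-inverseʳ (seq y n)))

    ≈-refl : ∀ {x} → x ≈ x
    ≈-refl = pointwise λ _ → refl

    ≈-sym : ∀ {x y} → x ≈ y → y ≈ x
    ≈-sym {x} {y} e = close (null-cong
      (λ n → solve 2 (λ a b → :- (a :- b) := b :- a) refl (seq x n) (seq y n))
      (null-neg (null e)))

    ≈-trans : ∀ {x y z} → x ≈ y → y ≈ z → x ≈ z
    ≈-trans {x} {y} {z} e f = close (null-cong
      (λ n → solve 3 (λ a b c → (a :- b) :+ (b :- c) := a :- c) refl (seq x n) (seq y n) (seq z n))
      (null-+ (null e) (null f)))

    +-cong : ∀ {x y u v} → x ≈ y → u ≈ v → x + u ≈ y + v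
    +-cong {x} {y} {u} {v} e f = close (null-cong
      (λ n → solve 4 (λ a b c d → (a :- b) :+ (c :- d) := (a :+ c) :- (b :+ d)) refl
               (seq x n) (seq y n) (seq u n) (seq v n))
      (null-+ (null e) (null f)))

    -‿cong : ∀ {x y} → x ≈ y → - x ≈ - y
    -‿cong {x} {y} e = close (null-cong
      (λ n → solve 2 (λ a b → :- (a :- b) := (:- a) :- (:- b)) refl (seq x n) (seq y n))
      (null-neg (null e)))

    *-cong : ∀ {x y u v} → x ≈ y → u ≈ v → x * u ≈ y * v
    *-cong {x} {y} {u} {v} e f = close (null-cong
      (λ n → solve 4 (λ a b c d → a :* (c :- d) :+ d :* (a :- b) := a :* c :- b :* d) refl
               (seq x n) (seq y n) (seq u n) (seq v n))
      (null-+ (null-* (bounded x) (null f)) (null-* (bounded v) (null e))))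

    recip-inverse : ∀ x x#0 → recip x x#0 * x ≈ 1ℝ
    recip-inverse x x#0 = close (null-cong-ev
      (ev-map (λ n ne → sym (1-1 (seq x n) ne))
        (away⇒≢0 {a = seq x} (away-cong {b = seq x} (λ n → ℚ.+-identityʳ (seq x n)) (away x#0))))
      (null-0 {a = λ _ → 0ℚ} λ _ → refl))
      where
      1-1 : ∀ q → ¬ q ≡ 0ℚ → inv q ℚ.* q ℚ.- 1ℚ ≡ 0ℚ
      1-1 q ne = trans (cong (ℚ._- 1ℚ) (inv-* ne)) (ℚ.+-inverseʳ 1ℚ)

    half-< : ∀ {ε} → 0ℚ ℚ.< ε → ½ ℚ.* ε ℚ.< ε
    half-< {ε} 0<ε = subst₂ ℚ._<_ (ℚ.+-identityʳ (½ ℚ.* ε)) (half ε)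
      (ℚ.+-monoʳ-< (½ ℚ.* ε) (half-pos 0<ε))

    apart-or-small : ∀ x {δ} → 0ℚ ℚ.< δ →
      Away id (seq x) ⊎ Eventually id λ n → ∣ seq x n ∣ ℚ.< δ
    apart-or-small x {δ} 0<δ with cauchy x (½ ℚ.* (½ ℚ.* δ)) (half-pos (half-pos 0<δ))
    ... | N , f with ∣ seq x N ∣ ℚ.<? ½ ℚ.* δ
    ...   | yes small = inj₂ (N , λ n N≤n → subst (∣ seq x n ∣ ℚ.<_) (half δ)
              (ℚ.≤-<-trans (∣p∣≤∣p-q∣+∣q∣ (seq x n) (seq x N))
                (ℚ.+-mono-< (ℚ.<-trans (f n N N≤n ℕ.≤-refl) (half-< (half-pos 0<δ))) small)))
    ...   | no large = inj₁ (½ ℚ.* (½ ℚ.* δ) , half-pos (half-pos 0<δ) , N , λ n N≤n →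
              +-cancel-< (½ ℚ.* (½ ℚ.* δ))
                (subst (ℚ._< ½ ℚ.* (½ ℚ.* δ) ℚ.+ ∣ seq x n ∣) (sym (half (½ ℚ.* δ)))
                  (ℚ.≤-<-trans (ℚ.≮⇒≥ large)
                    (ℚ.≤-<-trans (∣p∣≤∣p-q∣+∣q∣ (seq x N) (seq x n))
                      (ℚ.+-monoˡ-< ∣ seq x n ∣ (f N n ℕ.≤-refl N≤n))))))

    #-irrefl : ∀ {x y} → x ≈ y → ¬ x # y
    #-irrefl e (apart (ε , 0<ε , ev)) with ev-map₂ (λ _ → ℚ.<-asym) ev (null e ε 0<ε)
    ... | N , f = f N ℕ.≤-refl

    #-sym : ∀ {x y} → x # y → y # x
    #-sym {x} {y} (apart (ε , 0<ε , N , f)) = apart (ε , 0<ε , N , λ n N≤n →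
      subst (ε ℚ.<_) (∣p-q∣≡∣q-p∣ (seq x n) (seq y n)) (f n N≤n))

    #-cotrans : ∀ {x y} → x # y → ∀ z → x # z ⊎ z # y
    #-cotrans {x} {y} (apart (ε , 0<ε , ev)) z =
      Sum.map apart (λ small → apart (½ ℚ.* ε , half-pos 0<ε , ev-map₂ (λ n p q → +-cancel-< (½ ℚ.* ε) (subst (ℚ._< ½ ℚ.* ε ℚ.+ ∣ seq z n ℚ.- seq y n ∣) (sym (half ε))
          (ℚ.<-≤-trans p (ℚ.≤-trans (split n) (ℚ.+-monoˡ-≤ ∣ seq z n ℚ.- seq y n ∣ (ℚ.<⇒≤ q))))))
        ev small))
        (apart-or-small (x - z) (half-pos 0<ε))
      where
      split : ∀ n → ∣ seq x n ℚ.- seq y n ∣ ℚ.≤ ∣ seq x n ℚ.- seq z n ∣ ℚ.+ ∣ seq z n ℚ.- seq y n ∣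
      split n = subst (λ q → ∣ q ∣ ℚ.≤ ∣ seq x n ℚ.- seq z n ∣ ℚ.+ ∣ seq z n ℚ.- seq y n ∣)
        (solve 3 (λ a b c → (a :- c) :+ (c :- b) := a :- b) refl (seq x n) (seq y n) (seq z n))
        (ℚ.∣p+q∣≤∣p∣+∣q∣ (seq x n ℚ.- seq z n) (seq z n ℚ.- seq y n))

    #-tight : ∀ {x y} → ¬ x # y → x ≈ y
    #-tight {x} {y} ¬x#y = close λ ε 0<ε → case apart-or-small (x - y) 0<ε of λ where
      (inj₁ aw)    → ⊥-elim (¬x#y (apart aw))
      (inj₂ small) → small

    #-respˡ : ∀ {x y z} → x ≈ y → x # z → y # z
    #-respˡ {y = y} e x#z = Sum.[ (λ x#y → ⊥-elim (#-irrefl e x#y)) , id ] (#-cotrans x#z y)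

    1#0 : 1ℝ # 0ℝ
    1#0 = apart (½ , half-pos 0<1 , 0 , λ _ _ → half-< 0<1)

    *#0⇒#0 : ∀ {x y} → x * y # 0ℝ → x # 0ℝ
    *#0⇒#0 {x} {y} xy#0 = apart (away-cong (λ n → sym (ℚ.+-identityʳ (seq x n)))
      (away-*ˡ {a = seq x} (bounded y)
        (away-cong (λ n → ℚ.+-identityʳ (seq x n ℚ.* seq y n)) (away xy#0))))

    +#0⇒#0 : ∀ {x y} → x + y # 0ℝ → x # 0ℝ ⊎ y # 0ℝ
    +#0⇒#0 {x} {y} xy#0 = Sum.map₁
      (λ xy#y → apart (away-cong
        (λ n → solve 2 (λ a b → (a :+ b) :- b := a :- con 0ℚ) refl (seq x n) (seq y n))
        (away xy#y)))
      (#-cotrans xy#0 y)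

    #⇒-#0 : ∀ {x y} → x # y → x - y # 0ℝ
    #⇒-#0 {x} {y} x#y =
      apart (away-cong (λ n → sym (ℚ.+-identityʳ (seq x n ℚ.- seq y n))) (away x#y))

    -#0⇒# : ∀ {x y} → x - y # 0ℝ → x # y
    -#0⇒# {x} {y} x-y#0 =
      apart (away-cong (λ n → ℚ.+-identityʳ (seq x n ℚ.- seq y n)) (away x-y#0))

    sum²#0 : ∀ x y → x # 0ℝ ⊎ y # 0ℝ → x * x + y * y # 0ℝ
    sum²#0 x y (inj₁ (apart (ε , 0<ε , ev))) = apart (ε ℚ.* ε , *-pos 0<ε 0<ε , ev-map
      (λ n lt → sum²-bound (seq x n) (seq y n) 0<ε
                  (subst (λ q → ε ℚ.< ∣ q ∣) (ℚ.+-identityʳ (seq x n)) lt)) ev)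
    sum²#0 x y (inj₂ (apart (ε , 0<ε , ev))) = apart (ε ℚ.* ε , *-pos 0<ε 0<ε , ev-map
      (λ n lt → subst (λ q → ε ℚ.* ε ℚ.< ∣ q ℚ.- 0ℚ ∣)
                  (ℚ.+-comm (seq y n ℚ.* seq y n) (seq x n ℚ.* seq x n))
                  (sum²-bound (seq y n) (seq x n) 0<ε
                    (subst (λ q → ε ℚ.< ∣ q ∣) (ℚ.+-identityʳ (seq y n)) lt))) ev)

record ℂ : Set where
  constructor _+i_
  field
    re im : ℝ

open ℂ public

module Complex where

  private
    module R = Real
    open +-*-Solver
    open Data.Rational.Base using ()
      renaming (_+_ to infixl 6 _⊕_; _-_ to infixl 6 _⊖_; _*_ to infixl 7 _⊗_; -_ to infix 8 ⊖_)

    abstract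
      re-assoc : ∀ a b c d e f → (a ⊗ c ⊖ b ⊗ d) ⊗ e ⊖ (a ⊗ d ⊕ b ⊗ c) ⊗ f ≡
                                 a ⊗ (c ⊗ e ⊖ d ⊗ f) ⊖ b ⊗ (c ⊗ f ⊕ d ⊗ e)
      re-assoc = solve 6 (λ a b c d e f →
        (a :* c :- b :* d) :* e :- (a :* d :+ b :* c) :* f :=
        a :* (c :* e :- d :* f) :- b :* (c :* f :+ d :* e)) refl

      im-assoc : ∀ a b c d e f → (a ⊗ c ⊖ b ⊗ d) ⊗ f ⊕ (a ⊗ d ⊕ b ⊗ c) ⊗ e ≡
                                 a ⊗ (c ⊗ f ⊕ d ⊗ e) ⊕ b ⊗ (c ⊗ e ⊖ d ⊗ f)
      im-assoc = solve 6 (λ a b c d e f →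
        (a :* c :- b :* d) :* f :+ (a :* d :+ b :* c) :* e :=
        a :* (c :* f :+ d :* e) :+ b :* (c :* e :- d :* f)) refl

      re-comm : ∀ a b c d → a ⊗ c ⊖ b ⊗ d ≡ c ⊗ a ⊖ d ⊗ b
      re-comm = solve 4 (λ a b c d → a :* c :- b :* d := c :* a :- d :* b) refl

      im-comm : ∀ a b c d → a ⊗ d ⊕ b ⊗ c ≡ c ⊗ b ⊕ d ⊗ a
      im-comm = solve 4 (λ a b c d → a :* d :+ b :* c := c :* b :+ d :* a) refl

      re-identity : ∀ a b → 1ℚ ⊗ a ⊖ 0ℚ ⊗ b ≡ a
      re-identity = solve 2 (λ a b → con 1ℚ :* a :- con 0ℚ :* b := a) refl

      im-identity : ∀ a b → 1ℚ ⊗ b ⊕ 0ℚ ⊗ a ≡ b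
      im-identity = solve 2 (λ a b → con 1ℚ :* b :+ con 0ℚ :* a := b) refl

      re-distrib : ∀ a b c d e f → a ⊗ (c ⊕ e) ⊖ b ⊗ (d ⊕ f) ≡
                                   (a ⊗ c ⊖ b ⊗ d) ⊕ (a ⊗ e ⊖ b ⊗ f)
      re-distrib = solve 6 (λ a b c d e f →
        a :* (c :+ e) :- b :* (d :+ f) := (a :* c :- b :* d) :+ (a :* e :- b :* f)) refl

      im-distrib : ∀ a b c d e f → a ⊗ (d ⊕ f) ⊕ b ⊗ (c ⊕ e) ≡
                                   (a ⊗ d ⊕ b ⊗ c) ⊕ (a ⊗ f ⊕ b ⊗ e)
      im-distrib = solve 6 (λ a b c d e f →
        a :* (d :+ f) :+ b :* (c :+ e) := (a :* d :+ b :* c) :+ (a :* f :+ b :* e)) refl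

      re-inverse : ∀ a b k → (k ⊗ a) ⊗ a ⊖ (⊖ (k ⊗ b)) ⊗ b ≡ k ⊗ (a ⊗ a ⊕ b ⊗ b)
      re-inverse = solve 3 (λ a b k →
        (k :* a) :* a :- (:- (k :* b)) :* b := k :* (a :* a :+ b :* b)) refl

      im-inverse : ∀ a b k → (k ⊗ a) ⊗ b ⊕ (⊖ (k ⊗ b)) ⊗ a ≡ 0ℚ
      im-inverse = solve 3 (λ a b k → (k :* a) :* b :+ (:- (k :* b)) :* a := con 0ℚ) refl

      neg-swap : ∀ d b → ⊖ (d ⊗ b) ≡ b ⊗ (⊖ d)
      neg-swap = solve 2 (λ d b → :- (d :* b) := b :* (:- d)) refl

  infix 4 _≈_ _#_
  infixl 6 _+_ _-_
  infixl 7 _*_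
  infix 8 -_

  record _≈_ (z w : ℂ) : Set where
    constructor _,_
    field
      re≈ : re z R.≈ re w
      im≈ : im z R.≈ im w

  open _≈_ public

  data _#_ (z w : ℂ) : Set where
    re# : re z R.# re w → z # w
    im# : im z R.# im w → z # w

  0ℂ 1ℂ : ℂ
  0ℂ = R.0ℝ +i R.0ℝ
  1ℂ = R.1ℝ +i R.0ℝ

  _+_ _*_ : ℂ → ℂ → ℂ
  (a +i b) + (c +i d) = (a R.+ c) +i (b R.+ d)
  (a +i b) * (c +i d) = (a R.* c R.- b R.* d) +i (a R.* d R.+ b R.* c)

  -_ : ℂ → ℂ
  - (a +i b) = (R.- a) +i (R.- b)

  _-_ : ℂ → ℂ → ℂ
  z - w = z + (- w)

  abstract
    isCommutativeRing : IsCommutativeRing _≈_ _+_ _*_ -_ 0ℂ 1ℂ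
    isCommutativeRing = record
      { isRing = record
        { +-isAbelianGroup = record
          { isGroup = record
            { isMonoid = record
              { isSemigroup = record
                { isMagma = record
                  { isEquivalence = record
                    { refl = R.≈-refl , R.≈-refl
                    ; sym = λ (e , f) → R.≈-sym e , R.≈-sym f
                    ; trans = λ (e , f) (e′ , f′) → R.≈-trans e e′ , R.≈-trans f f′
                    }
                  ; ∙-cong = λ (e , f) (e′ , f′) → R.+-cong e e′ , R.+-cong f f′
                  }
                ; assoc = λ x y z →
                    R.pointwise (λ n → ℚ.+-assoc (ν x n) (ν y n) (ν z n)) ,
                    R.pointwise (λ n → ℚ.+-assoc (μ x n) (μ y n) (μ z n))
                }
              ; identity =
                  (λ x → R.pointwise (λ n → ℚ.+-identityˡ (ν x n)) ,
                         R.pointwise (λ n → ℚ.+-identityˡ (μ x n))) ,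
                  (λ x → R.pointwise (λ n → ℚ.+-identityʳ (ν x n)) ,
                         R.pointwise (λ n → ℚ.+-identityʳ (μ x n)))
              }
            ; inverse =
                (λ x → R.pointwise (λ n → ℚ.+-inverseˡ (ν x n)) ,
                       R.pointwise (λ n → ℚ.+-inverseˡ (μ x n))) ,
                (λ x → R.pointwise (λ n → ℚ.+-inverseʳ (ν x n)) ,
                       R.pointwise (λ n → ℚ.+-inverseʳ (μ x n)))
            ; ⁻¹-cong = λ (e , f) → R.-‿cong e , R.-‿cong f
            }
          ; comm = λ x y → R.pointwise (λ n → ℚ.+-comm (ν x n) (ν y n)) ,
                           R.pointwise (λ n → ℚ.+-comm (μ x n) (μ y n))
          }
        ; *-cong = λ (e , f) (e′ , f′) →
            R.+-cong (R.*-cong e e′) (R.-‿cong (R.*-cong f f′)) ,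
            R.+-cong (R.*-cong e f′) (R.*-cong f e′)
        ; *-assoc = λ x y z →
            R.pointwise (λ n → re-assoc (ν x n) (μ x n) (ν y n) (μ y n) (ν z n) (μ z n)) ,
            R.pointwise (λ n → im-assoc (ν x n) (μ x n) (ν y n) (μ y n) (ν z n) (μ z n))
        ; *-identity =
            (λ x → *-identityˡ x) ,
            (λ x → ≈-trans (*-comm x 1ℂ) (*-identityˡ x))
        ; distrib =
            distribˡ ,
            (λ x y z → ≈-trans (*-comm (y + z) x) (≈-trans (distribˡ x y z)
              (+-cong (*-comm x y) (*-comm x z))))
        }
      ; *-comm = *-comm
      }
      where
      ν μ : ℂ → ℕ → ℚ
      ν z = ℝ.seq (re z)
      μ z = ℝ.seq (im z)

      ≈-trans : ∀ {x y z} → x ≈ y → y ≈ z → x ≈ z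
      ≈-trans (e , f) (e′ , f′) = R.≈-trans e e′ , R.≈-trans f f′

      +-cong : ∀ {x y u v} → x ≈ y → u ≈ v → x + u ≈ y + v
      +-cong (e , f) (e′ , f′) = R.+-cong e e′ , R.+-cong f f′

      *-comm : ∀ x y → x * y ≈ y * x
      *-comm x y =
        R.pointwise (λ n → re-comm (ν x n) (μ x n) (ν y n) (μ y n)) ,
        R.pointwise (λ n → im-comm (ν x n) (μ x n) (ν y n) (μ y n))

      *-identityˡ : ∀ x → 1ℂ * x ≈ x
      *-identityˡ x =
        R.pointwise (λ n → re-identity (ν x n) (μ x n)) ,
        R.pointwise (λ n → im-identity (ν x n) (μ x n))

      distribˡ : ∀ x y z → x * (y + z) ≈ x * y + x * z
      distribˡ x y z =
        R.pointwise (λ n → re-distrib (ν x n) (μ x n) (ν y n) (μ y n) (ν z n) (μ z n)) ,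
        R.pointwise (λ n → im-distrib (ν x n) (μ x n) (ν y n) (μ y n) (ν z n) (μ z n))

    #0⇒invertible : ∀ z → z # 0ℂ → ∃ λ w → w * z ≈ 1ℂ
    #0⇒invertible (a +i b) z#0 =
      (k R.* a) +i (R.- (k R.* b)) ,
      (R.≈-trans (R.pointwise λ n → re-inverse (ℝ.seq a n) (ℝ.seq b n) (ℝ.seq k n))
         (R.recip-inverse norm norm#0) ,
       R.pointwise λ n → im-inverse (ℝ.seq a n) (ℝ.seq b n) (ℝ.seq k n))
      where
      parts : a R.# R.0ℝ ⊎ b R.# R.0ℝ
      parts = case z#0 of λ where
        (re# p) → inj₁ p
        (im# p) → inj₂ p
      norm : ℝ
      norm = a R.* a R.+ b R.* b
      norm#0 : norm R.# R.0ℝ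
      norm#0 = R.sum²#0 a b parts
      k : ℝ
      k = R.recip norm norm#0

    invertible⇒#0 : ∀ z w → w * z ≈ 1ℂ → z # 0ℂ
    invertible⇒#0 (a +i b) (c +i d) (e , _) = Sum.[
      (λ p → re# (R.*#0⇒#0 {a} {c} (R.#-respˡ (R.pointwise λ n → ℚ.*-comm (ℝ.seq c n) (ℝ.seq a n)) p))) ,
      (λ p → im# (R.*#0⇒#0 {b} {R.- d} (R.#-respˡ (R.pointwise λ n →
        neg-swap (ℝ.seq d n) (ℝ.seq b n)) p))) ]
      (R.+#0⇒#0 (R.#-respˡ (R.≈-sym e) R.1#0))

  heytingField : HeytingField 0ℓ 0ℓ 0ℓ
  heytingField = record
    { _≈_ = _≈_
    ; _#_ = _#_
    ; _+_ = _+_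
    ; _*_ = _*_
    ; -_  = -_
    ; 0#  = 0ℂ
    ; 1#  = 1ℂ
    ; isHeytingField = record
      { isHeytingCommutativeRing = record
        { isCommutativeRing = isCommutativeRing
        ; isApartnessRelation = record
          { irrefl  = #-irrefl
          ; sym     = #-sym
          ; cotrans = #-cotrans
          }
        ; #⇒invertible = λ {x} {y} x#y → case #0⇒invertible (x - y) (#⇒-#0 x#y) of λ
            (w , e) → w , e , ≈-trans (*-comm (x - y) w) e
        ; invertible⇒# = λ {x} {y} (w , e , _) → -#0⇒# (invertible⇒#0 (x - y) w e)
        }
      ; tight = λ x y → #-tight , (λ e p → #-irrefl e p)
      }
    }
    where
    open IsCommutativeRing isCommutativeRing using (*-comm) renaming (trans to ≈-trans)

    abstract
      #-irrefl : ∀ {x y} → x ≈ y → ¬ x # y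
      #-irrefl (e , _) (re# p) = R.#-irrefl e p
      #-irrefl (_ , f) (im# p) = R.#-irrefl f p

      #-sym : ∀ {x y} → x # y → y # x
      #-sym (re# p) = re# (R.#-sym p)
      #-sym (im# p) = im# (R.#-sym p)

      #-cotrans : ∀ {x y} → x # y → ∀ z → x # z ⊎ z # y
      #-cotrans (re# p) z = Sum.map re# re# (R.#-cotrans p (re z))
      #-cotrans (im# p) z = Sum.map im# im# (R.#-cotrans p (im z))

      #-tight : ∀ {x y} → ¬ x # y → x ≈ y
      #-tight ¬p = R.#-tight (¬p ∘ re#) , R.#-tight (¬p ∘ im#)

      #⇒-#0 : ∀ {x y} → x # y → x - y # 0ℂ
      #⇒-#0 (re# p) = re# (R.#⇒-#0 p)
      #⇒-#0 (im# p) = im# (R.#⇒-#0 p)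

      -#0⇒# : ∀ {x y} → x - y # 0ℂ → x # y
      -#0⇒# (re# p) = re# (R.-#0⇒# p)
      -#0⇒# (im# p) = im# (R.-#0⇒# p)

open HeytingField Complex.heytingField
  using (_≈_; _#_; _+_; _*_; 0#; 1#; heytingCommutativeRing)
open Semiring (CommutativeRing.semiring
  (HeytingCommutativeRing.commutativeRing heytingCommutativeRing))
  using (rawSemiring)
open import Algebra.Definitions.RawSemiring rawSemiring
  using (_^_; product) renaming (_×_ to _·_)

∑ : {A : Set} → List A → (A → ℂ) → ℂ
∑ xs f = List.foldr (λ x s → f x + s) 0# xs

InfinitelyMany : (ℕ → Set) → Set
InfinitelyMany P = ∀ N → ∃ λ n → N ℕ.< n × P n

-- Arithmetic functions live on the positive integers; the value at 0 is junk
-- and is never consulted below.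
Arithmetic : Set
Arithmetic = ℕ → ℂ

record IsMultiplicative (α : Arithmetic) : Set where
  field
    nonzero        : ∃ λ n → NonZero n × α n # 0#
    multiplicative : ∀ m n → .{{NonZero m}} → .{{NonZero n}} →
                     gcd m n ≡ 1 → α (m ℕ.* n) ≈ α m * α n

infixl 7 _⊛_

-- Dirichlet convolution; k stands for the divisor d = k + 1 of n.
_⊛_ : Arithmetic → Arithmetic → Arithmetic
(α ⊛ β) n = ∑ (List.filter (λ k → suc k ∣? n) (List.upTo n))
              (λ k → α (suc k) * β (n ℕ./ suc k))

-- The identity for Dirichlet convolution.
δ : Arithmetic
δ n = if n ℕ.≡ᵇ 1 then 1# else 0#

⨂ : ∀ {r} → (Fin r → Arithmetic) → Arithmetic
⨂ = Vector.foldr _⊛_ δ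

_IsInverseOf_ : Arithmetic → Arithmetic → Set
γ⁻¹ IsInverseOf γ = ∀ n → .{{NonZero n}} → (γ ⊛ γ⁻¹) n ≈ δ n

record IsDegreeOne (p : ℕ) (β : Arithmetic) : Set where
  field
    isMultiplicative : IsMultiplicative β
    base             : ℂ
    base#0           : base # 0#
    powers           : ∀ n → β (p ℕ.^ n) ≈ base ^ n

-- α agrees on the powers of p with a convolution product of valence ⟨ r , s ⟩
-- in normal form.
record IsLocallyNormalForm (p r s : ℕ) (α : Arithmetic) : Set where
  field
    β           : Fin r → Arithmetic
    γ γ⁻¹       : Fin s → Arithmetic
    β-degreeOne : ∀ i → IsDegreeOne p (β i)
    γ-degreeOne : ∀ j → IsDegreeOne p (γ j)
    γ-inverse   : ∀ j → γ⁻¹ j IsInverseOf γ j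
    normal      : ∀ i j → β i p # γ j p
    factored    : ∀ n → α (p ℕ.^ n) ≈ (⨂ β ⊛ ⨂ γ⁻¹) (p ℕ.^ n)

-- In a tuple a of length n, the entry at i : Fin n is the exponent of the
-- variable of index j = i + 1.
weight : ∀ {n} → Vec ℕ n → ℕ
weight {n} a = Vec.sum (Vec.tabulate λ (i : Fin n) → suc (toℕ i) ℕ.* Vec.lookup a i)

vectors : {A : Set} → List A → ∀ n → List (Vec A n)
vectors xs zero    = [] ∷ []
vectors xs (suc n) = List.cartesianProductWith _∷_ xs (vectors xs n)

-- No exponent can exceed n in a tuple of weight n.
exponents : ∀ n → List (Vec ℕ n)
exponents n = List.filter (λ a → weight a ℕ.≟ n) (vectors (List.upTo (suc n)) n)

factorials : ∀ {n} → Vec ℕ n → ℕ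
factorials = Vec.foldr _ (λ k m → k ! ℕ.* m) 1

factorials≢0 : ∀ {n} (a : Vec ℕ n) → NonZero (factorials a)
factorials≢0 []      = _
factorials≢0 (k ∷ a) = ℕ.m*n≢0 (k !) (factorials a) {{k !≢0}} {{factorials≢0 a}}

multinomial : ∀ {n} → Vec ℕ n → ℕ
multinomial a = ((Vec.sum a) ! ℕ./ factorials a) {{factorials≢0 a}}

-- The generalized Fibonacci polynomial Fₙ(t₁,…,tₙ); t is indexed from 1 and
-- t 0 is not used.
F : ℕ → (ℕ → ℂ) → ℂ
F n t = ∑ (exponents n) λ a →
  multinomial a · product (λ (i : Fin n) → t (suc (toℕ i)) ^ Vec.lookup a i)

AreParameters : ℕ → Arithmetic → (ℕ → ℂ) → Set
AreParameters p α t = ∀ n → F n t ≈ α (p ℕ.^ n)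

record IsType4 (p : ℕ) (α : Arithmetic) : Set where
  field
    values     : InfinitelyMany λ n → α (p ℕ.^ n) # 0#
    parameters : ∀ t → AreParameters p α t → InfinitelyMany λ j → t j # 0#

{-# OPTIONS --safe #-}
module Submission where

-- Let A = ∑ α(pⁿ)Xⁿ be the Bell series of α, and put P = ∏(1 − bᵢX) and
-- Q = ∏(1 − cⱼX), with b and c the values at p of the factors β and γ.
-- Then P A = Q.  The parameters satisfy (1 − T) A = 1 for T = ∑ tⱼXʲ, which
-- is the recurrence Fₙ₊₁ = ∑ tᵢ₊₁ Fₙ₋ᵢ, hence Q (1 − T) = P, and both claims are
-- instances of one: if P f = Q with b₀ apart from 0 and from all cⱼ, then
-- infinitely many coefficients of f are apart from 0.  Indeed
-- g = ∏_{i ≥ 1}(1 − bᵢX) f satisfies (1 − b₀X) g = Q, so its coefficient at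
-- s + n is b₀ⁿ ∏(b₀ − cⱼ), which is apart from 0; and when a coefficient of
-- (1 − bX) f is apart from 0, so is one of the two coefficients of f it
-- is computed from.

open import Algebra.Apartness using (HeytingCommutativeRing; HeytingField)
open import Algebra.Bundles using (CommutativeRing; CommutativeSemiring)
open import Data.Bool.Base using (true; false; if_then_else_)
open import Data.Fin.Base using (Fin; zero; suc; toℕ)
open import Data.List.Base as List using (List; []; _∷_; _++_)
open import Data.List.Membership.Propositional using (_∈_)
open import Data.List.Membership.Propositional.Properties
  using (∈-filter⁺; ∈-filter⁻; ∈-upTo⁺; ∈-applyUpTo⁺; ∈-applyUpTo⁻)
open import Data.List.Membership.Propositional.Properties.WithK using (unique∧set⇒bag)
open import Data.List.Relation.Binary.BagAndSetEquality using (∼bag⇒↭)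
open import Data.List.Relation.Binary.Permutation.Propositional as ↭ using (_↭_)
import Data.List.Relation.Unary.Unique.Propositional.Properties as Unique
open import Data.Nat.Base as ℕ using (ℕ; zero; suc; z≤n; s≤s; _≤_; _!; NonZero)
open import Data.Nat.Combinatorics
  using (_C_; nCn≡1; nCk≡nC[n∸k]; nCk+nC[k+1]≡[n+1]C[k+1]; nCk≡n!/k![n-k]!; k![n∸k]!∣n!)
open import Data.Nat.Coprimality using (Coprime; coprime-divisor)
open import Data.Nat.Divisibility using (_∣_; _∣?_; divides-refl; ∣1⇒≡1; *-cancelˡ-∣; n∣m*n)
import Data.Nat.DivMod as ℕ
open import Data.Nat.Primality using (Prime; prime⇒nonZero; prime⇒nonTrivial; prime⇒irreducible)
import Data.Nat.Properties as ℕ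
open import Data.Nat.Properties using (_!≢0; _!*_!≢0)
open import Data.Nat.Solver using (module +-*-Solver)
open import Data.Product.Base using (∃; _×_; _,_)
open import Data.Sum.Base as Sum using (_⊎_; inj₁; inj₂)
open import Data.Vec.Base as Vec using (Vec; []; _∷_; _∷ʳ_)
import Data.Vec.Functional as Vector
open import Defs
open import Function.Base using (_∘_; id)
open import Function.Bundles using (mk⇔)
open import Level using (Level; 0ℓ)
open import Relation.Binary.PropositionalEquality as ≡ using (_≡_)
import Relation.Binary.Reasoning.Setoid as SetoidReasoning
open import Relation.Nullary using (does; yes; no)
open import Relation.Unary using (Pred; Decidable)

-- Formal power series as coefficient sequences, and multiplication by linear factors.

module Series {c ℓ : Level} (R : CommutativeRing c ℓ) where
  open CommutativeRing R hiding (zero)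
  open import Algebra.Definitions.RawSemiring (CommutativeSemiring.rawSemiring commutativeSemiring)
    using (_^_)
  open import Algebra.Solver.Ring.NaturalCoefficients.Default commutativeSemiring
    using (solve; _:+_; _:*_; _:=_)
  open SetoidReasoning setoid

  infix 4 _≋_
  infixl 7 _⋆_
  infixr 8 [1-_X]_ ∏[1-_X]_

  _≋_ : (f g : ℕ → Carrier) → Set ℓ
  f ≋ g = ∀ n → f n ≈ g n

  ε : ℕ → Carrier
  ε zero    = 1#
  ε (suc _) = 0#

  -- The Cauchy product, by recursion that shifts the left factor: indices are never subtracted, and
  -- its laws follow by induction that peels off `f 0`.
  _⋆_ : (f g : ℕ → Carrier) → ℕ → Carrier
  (f ⋆ g) zero    = f 0 * g 0
  (f ⋆ g) (suc n) = f 0 * g (suc n) + (f ∘ suc ⋆ g) n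

  X·_ : (ℕ → Carrier) → ℕ → Carrier
  (X· f) zero    = 0#
  (X· f) (suc n) = f n

  [1-_X]_ : Carrier → (ℕ → Carrier) → ℕ → Carrier
  ([1- c X] f) n = f n + - c * (X· f) n

  -- The polynomial is an operator on series, applied one linear factor at a time. Since these
  -- operators pass through either factor of `⋆`, neither associativity nor commutativity of `⋆` is
  -- called for.
  ∏[1-_X]_ : ∀ {r} → (Fin r → Carrier) → (ℕ → Carrier) → ℕ → Carrier
  ∏[1- c X] f = Vector.foldr [1-_X]_ f c

  -- A coefficient of a product only sees coefficients of lower or equal degree. The bound matters
  -- in `Fbox-suc`, where a fixed box computes the right sums only in low degrees.
  ⋆-cong-≤ : ∀ {f f′ g g′} n → (∀ k → k ℕ.≤ n → f k ≈ f′ k) → (∀ k → k ℕ.≤ n → g k ≈ g′ k) →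
             (f ⋆ g) n ≈ (f′ ⋆ g′) n
  ⋆-cong-≤ zero    p q = *-cong (p 0 z≤n) (q 0 z≤n)
  ⋆-cong-≤ (suc n) p q = +-cong (*-cong (p 0 z≤n) (q (suc n) ℕ.≤-refl))
    (⋆-cong-≤ n (λ k k≤n → p (suc k) (s≤s k≤n)) (λ k k≤n → q k (ℕ.m≤n⇒m≤1+n k≤n)))

  ⋆-cong : ∀ {f f′ g g′} → f ≋ f′ → g ≋ g′ → f ⋆ g ≋ f′ ⋆ g′
  ⋆-cong p q n = ⋆-cong-≤ n (λ k _ → p k) (λ k _ → q k)

  ⋆-linearˡ : ∀ x f g h → (λ n → f n + x * g n) ⋆ h ≋ λ n → (f ⋆ h) n + x * (g ⋆ h) n
  ⋆-linearˡ x f g h zero    =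
    solve 4 (λ x f g h → (f :+ x :* g) :* h := f :* h :+ x :* (g :* h)) refl x (f 0) (g 0) (h 0)
  ⋆-linearˡ x f g h (suc n) = trans (+-congˡ (⋆-linearˡ x (f ∘ suc) (g ∘ suc) h n))
    (solve 6 (λ x f g h F G → (f :+ x :* g) :* h :+ (F :+ x :* G) :=
                              (f :* h :+ F) :+ x :* (g :* h :+ G)) refl
       x (f 0) (g 0) (h (suc n)) ((f ∘ suc ⋆ h) n) ((g ∘ suc ⋆ h) n))

  ⋆-linearʳ : ∀ x f g h → f ⋆ (λ n → g n + x * h n) ≋ λ n → (f ⋆ g) n + x * (f ⋆ h) n
  ⋆-linearʳ x f g h zero    =
    solve 4 (λ x f g h → f :* (g :+ x :* h) := f :* g :+ x :* (f :* h)) refl x (f 0) (g 0) (h 0)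
  ⋆-linearʳ x f g h (suc n) = trans (+-congˡ (⋆-linearʳ x (f ∘ suc) g h n))
    (solve 6 (λ x f g h G H → f :* (g :+ x :* h) :+ (G :+ x :* H) :=
                              (f :* g :+ G) :+ x :* (f :* h :+ H)) refl
       x (f 0) (g (suc n)) (h (suc n)) ((f ∘ suc ⋆ g) n) ((f ∘ suc ⋆ h) n))

  X·-⋆ˡ : ∀ f g → (X· f) ⋆ g ≋ X· (f ⋆ g)
  X·-⋆ˡ f g zero    = zeroˡ (g 0)
  X·-⋆ˡ f g (suc n) = trans (+-congʳ (zeroˡ (g (suc n)))) (+-identityˡ ((f ⋆ g) n))

  X·-⋆ʳ : ∀ f g → f ⋆ (X· g) ≋ X· (f ⋆ g)
  X·-⋆ʳ f g zero          = zeroʳ (f 0)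
  X·-⋆ʳ f g (suc zero)    = trans (+-congˡ (zeroʳ (f 1))) (+-identityʳ (f 0 * g 0))
  X·-⋆ʳ f g (suc (suc n)) = +-congˡ (X·-⋆ʳ (f ∘ suc) g (suc n))

  ⋆-zeroˡ : ∀ g → (λ _ → 0#) ⋆ g ≋ λ _ → 0#
  ⋆-zeroˡ g zero    = zeroˡ (g 0)
  ⋆-zeroˡ g (suc n) = trans (+-cong (zeroˡ (g (suc n))) (⋆-zeroˡ g n)) (+-identityˡ 0#)

  ⋆-identityˡ : ∀ g → ε ⋆ g ≋ g
  ⋆-identityˡ g zero    = *-identityˡ (g 0)
  ⋆-identityˡ g (suc n) =
    trans (+-cong (*-identityˡ (g (suc n))) (⋆-zeroˡ g n)) (+-identityʳ (g (suc n)))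

  ⋆-identityʳ : ∀ f → f ⋆ ε ≋ f
  ⋆-identityʳ f zero    = *-identityʳ (f 0)
  ⋆-identityʳ f (suc n) =
    trans (+-cong (zeroʳ (f 0)) (⋆-identityʳ (f ∘ suc) n)) (+-identityˡ (f (suc n)))

  [1-X]-cong : ∀ {c c′ f g} → c ≈ c′ → f ≋ g → [1- c X] f ≋ [1- c′ X] g
  [1-X]-cong c≈c′ f≋g zero    = +-cong (f≋g 0) (*-congʳ (-‿cong c≈c′))
  [1-X]-cong c≈c′ f≋g (suc n) = +-cong (f≋g (suc n)) (*-cong (-‿cong c≈c′) (f≋g n))

  [1-X]-⋆ˡ : ∀ c f g → ([1- c X] f) ⋆ g ≋ [1- c X] (f ⋆ g)
  [1-X]-⋆ˡ c f g n = trans (⋆-linearˡ (- c) f (X· f) g n) (+-congˡ (*-congˡ (X·-⋆ˡ f g n)))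

  [1-X]-⋆ʳ : ∀ c f g → f ⋆ ([1- c X] g) ≋ [1- c X] (f ⋆ g)
  [1-X]-⋆ʳ c f g n = trans (⋆-linearʳ (- c) f g (X· g) n) (+-congˡ (*-congˡ (X·-⋆ʳ f g n)))

  ∏[1-X]-cong : ∀ {r} (c : Fin r → Carrier) {f g} → f ≋ g → ∏[1- c X] f ≋ ∏[1- c X] g
  ∏[1-X]-cong {zero}  c f≋g = f≋g
  ∏[1-X]-cong {suc r} c f≋g = [1-X]-cong refl (∏[1-X]-cong (c ∘ suc) f≋g)

  ∏[1-X]-⋆ˡ : ∀ {r} (c : Fin r → Carrier) f g → (∏[1- c X] f) ⋆ g ≋ ∏[1- c X] (f ⋆ g)
  ∏[1-X]-⋆ˡ {zero}  c f g n = refl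
  ∏[1-X]-⋆ˡ {suc r} c f g n = trans ([1-X]-⋆ˡ (c zero) (∏[1- c ∘ suc X] f) g n)
    ([1-X]-cong refl (∏[1-X]-⋆ˡ (c ∘ suc) f g) n)

  ∏[1-X]-⋆ʳ : ∀ {r} (c : Fin r → Carrier) f g → f ⋆ (∏[1- c X] g) ≋ ∏[1- c X] (f ⋆ g)
  ∏[1-X]-⋆ʳ {zero}  c f g n = refl
  ∏[1-X]-⋆ʳ {suc r} c f g n = trans ([1-X]-⋆ʳ (c zero) f (∏[1- c ∘ suc X] g) n)
    ([1-X]-cong refl (∏[1-X]-⋆ʳ (c ∘ suc) f g) n)

  [1-X]-geometric : ∀ b → [1- b X] (b ^_) ≋ ε
  [1-X]-geometric b zero    = trans (+-congˡ (zeroʳ (- b))) (+-identityʳ 1#)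
  [1-X]-geometric b (suc n) = trans (sym (distribʳ (b ^ n) b (- b)))
    (trans (*-congʳ (-‿inverseʳ b)) (zeroˡ (b ^ n)))

  -- Since (1 − bX)⁻¹ = ∑ bⁿXⁿ, a common factor can be moved to the other side.
  [1-X]-solve : ∀ b f g → [1- b X] f ≋ g → f ≋ (b ^_) ⋆ g
  [1-X]-solve b f g eq n = begin
    f n                          ≈⟨ ⋆-identityˡ f n ⟨
    (ε ⋆ f) n                    ≈⟨ ⋆-cong ([1-X]-geometric b) (λ _ → refl) n ⟨
    (([1- b X] (b ^_)) ⋆ f) n    ≈⟨ [1-X]-⋆ˡ b (b ^_) f n ⟩
    ([1- b X] ((b ^_) ⋆ f)) n    ≈⟨ [1-X]-⋆ʳ b (b ^_) f n ⟨
    ((b ^_) ⋆ ([1- b X] f)) n    ≈⟨ ⋆-cong (λ _ → refl) eq n ⟩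
    ((b ^_) ⋆ g) n               ∎

  -- As bⁿ⁺¹ - c bⁿ = (b - c) bⁿ, each factor 1 - cX rescales a geometric series by b - c and moves
  -- it up one degree; `s` factors disturb only the first `s` coefficients.
  ∏[1-X]-geometric : ∀ {s} b (c : Fin s → Carrier) n →
    (∏[1- c X] (b ^_)) (s ℕ.+ n) ≈ Vector.foldr _*_ (b ^ n) (λ j → b - c j)
  ∏[1-X]-geometric {zero}  b c n = refl
  ∏[1-X]-geometric {suc s} b c n = begin
    A (suc (s ℕ.+ n)) + - c zero * A (s ℕ.+ n)  ≡⟨ ≡.cong (λ k → A k + - c zero * A (s ℕ.+ n)) (ℕ.+-suc s n) ⟨
    A (s ℕ.+ suc n) + - c zero * A (s ℕ.+ n)
      ≈⟨ +-cong (trans (∏[1-X]-geometric b c′ (suc n)) (pull c′)) (*-congˡ (∏[1-X]-geometric b c′ n)) ⟩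
    b * B + - c zero * B                        ≈⟨ distribʳ B b (- c zero) ⟨
    (b - c zero) * B                            ∎
    where
    c′ : Fin s → Carrier
    c′ = c ∘ suc
    A : ℕ → Carrier
    A = ∏[1- c′ X] (b ^_)
    B : Carrier
    B = Vector.foldr _*_ (b ^ n) (λ j → b - c′ j)
    pull : ∀ {s} (c : Fin s → Carrier) → Vector.foldr _*_ (b ^ suc n) (λ j → b - c j) ≈
                                          b * Vector.foldr _*_ (b ^ n) (λ j → b - c j)
    pull {zero}  c = refl
    pull {suc s} c = trans (*-congˡ (pull (c ∘ suc)))
      (solve 3 (λ x b y → x :* (b :* y) := b :* (x :* y)) refl
         (b - c zero) b (Vector.foldr _*_ (b ^ n) (λ j → b - c (suc j))))

-- Apartness from 0, and series with infinitely many coefficients apart from 0.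

module NonVanishing {c ℓ : Level} (K : HeytingCommutativeRing c ℓ 0ℓ) where
  open HeytingCommutativeRing K hiding (zero)
  open CommutativeRing commutativeRing
    using (ring; commutativeSemiring)
  open import Algebra.Apartness.Properties.HeytingCommutativeRing K
  open import Algebra.Definitions.RawSemiring (CommutativeSemiring.rawSemiring commutativeSemiring)
    using (_^_)
  open import Algebra.Properties.Ring ring using (-0#≈0#)
  open Series commutativeRing
    using (_≋_; ε; _⋆_; [1-_X]_; ∏[1-_X]_; ∏[1-X]-cong; ∏[1-X]-⋆ʳ; ∏[1-X]-geometric; [1-X]-solve; ⋆-identityʳ)
  open SetoidReasoning setoid

  -- Apartness of two elements amounts to invertibility of their difference, so it depends on the
  -- difference alone.
  #-difference : ∀ {x y u v} → x - y ≈ u - v → x # y → u # v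
  #-difference eq x#y with #⇒invertible x#y
  ... | w , w*[x-y]≈1 , _ = invertibleˡ⇒# (w , trans (*-congˡ (sym eq)) w*[x-y]≈1)

  x#y⇒x-y#0 : ∀ {x y} → x # y → x - y # 0#
  x#y⇒x-y#0 {x} {y} = #-difference (sym (x-0≈x (x - y)))

  -- Cotransitivity compares `x + y` and 0 with `y`; in the first case the difference is `x`.
  +#0⇒#0 : ∀ {x y} → x + y # 0# → x # 0# ⊎ y # 0#
  +#0⇒#0 {x} {y} x+y#0 = Sum.map₁ (#-difference x+y-y≈x-0) (#-cotrans x+y#0 y)
    where
    x+y-y≈x-0 : x + y - y ≈ x - 0#
    x+y-y≈x-0 = trans (+-assoc x y (- y)) (+-congˡ (trans (-‿inverseʳ y) (sym -0#≈0#)))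

  -- If `w` inverts `x * y`, then `w * x` inverts `y`.
  *#0⇒#0ʳ : ∀ {x y} → x * y # 0# → y # 0#
  *#0⇒#0ʳ {x} {y} xy#0 with #⇒invertible xy#0
  ... | w , w*[xy-0]≈1 , _ = invertibleˡ⇒# (w * x , (begin
    w * x * (y - 0#)    ≈⟨ *-congˡ (x-0≈x y) ⟩
    w * x * y           ≈⟨ *-assoc w x y ⟩
    w * (x * y)         ≈⟨ *-congˡ (x-0≈x (x * y)) ⟨
    w * (x * y - 0#)    ≈⟨ w*[xy-0]≈1 ⟩
    1#                  ∎))

  -x#0⇒x#0 : ∀ {x} → - x # 0# → x # 0#
  -x#0⇒x#0 {x} = #-sym ∘ #-difference (trans (x-0≈x (- x)) (sym (+-identityˡ (- x))))

  ^#0 : ∀ {x} → x # 0# → ∀ n → x ^ n # 0#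
  ^#0 x#0 zero    = 1#0
  ^#0 x#0 (suc n) = x#0y#0→xy#0 x#0 (^#0 x#0 n)

  product#0 : ∀ {s x} (y : Fin s → Carrier) → x # 0# → (∀ j → y j # 0#) →
              Vector.foldr _*_ x y # 0#
  product#0 {zero}  y x#0 y#0 = x#0
  product#0 {suc s} y x#0 y#0 = x#0y#0→xy#0 (y#0 zero) (product#0 (y ∘ suc) x#0 (y#0 ∘ suc))

  [1-X]-infinitelyMany : ∀ b f →
    InfinitelyMany (λ n → ([1- b X] f) n # 0#) → InfinitelyMany (λ n → f n # 0#)
  -- The coefficient at n + 1 involves those of `f` at n + 1 and at n. Asking for an index beyond N
  -- + 1 keeps the lower of the two beyond N.
  [1-X]-infinitelyMany b f inf N with inf (suc N)
  ... | suc n , s≤s N<n , p with +#0⇒#0 p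
  ...   | inj₁ f[1+n]#0 = suc n , ℕ.m≤n⇒m≤1+n N<n , f[1+n]#0
  ...   | inj₂ bfn#0    = n , N<n , *#0⇒#0ʳ bfn#0

  ∏[1-X]-infinitelyMany : ∀ {r} (b : Fin r → Carrier) f →
    InfinitelyMany (λ n → (∏[1- b X] f) n # 0#) → InfinitelyMany (λ n → f n # 0#)
  ∏[1-X]-infinitelyMany {zero}  b f inf = inf
  ∏[1-X]-infinitelyMany {suc r} b f inf =
    ∏[1-X]-infinitelyMany (b ∘ suc) f ([1-X]-infinitelyMany (b zero) (∏[1- b ∘ suc X] f) inf)

  quotient-infinitelyMany : ∀ {r s} (b : Fin (suc r) → Carrier) (c : Fin s → Carrier) f →
    b zero # 0# → (∀ j → b zero # c j) → ∏[1- b X] f ≋ ∏[1- c X] ε →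
    InfinitelyMany (λ n → f n # 0#)
  quotient-infinitelyMany {s = s} b c f b₀#0 b₀#c eq =
    -- The offset `s` skips the coefficients below degree `s`, where the closed form does not apply,
    -- and `suc N` makes the index exceed N.
    ∏[1-X]-infinitelyMany (b ∘ suc) f λ N → s ℕ.+ suc N , ℕ.m≤n+m (suc N) s ,
      #-congʳ (sym (coefficient (suc N)))
        (product#0 (λ j → b zero - c j) (^#0 b₀#0 (suc N)) (λ j → x#y⇒x-y#0 (b₀#c j)))
    where
    b₀ : Carrier
    b₀ = b zero
    g : ℕ → Carrier
    g = ∏[1- b ∘ suc X] f
    coefficient : ∀ n → g (s ℕ.+ n) ≈ Vector.foldr _*_ (b₀ ^ n) (λ j → b₀ - c j)
    coefficient n = begin
      g (s ℕ.+ n)                                  ≈⟨ [1-X]-solve b₀ g (∏[1- c X] ε) eq (s ℕ.+ n) ⟩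
      ((b₀ ^_) ⋆ (∏[1- c X] ε)) (s ℕ.+ n)          ≈⟨ ∏[1-X]-⋆ʳ c (b₀ ^_) ε (s ℕ.+ n) ⟩
      (∏[1- c X] ((b₀ ^_) ⋆ ε)) (s ℕ.+ n)          ≈⟨ ∏[1-X]-cong c (⋆-identityʳ (b₀ ^_)) (s ℕ.+ n) ⟩
      (∏[1- c X] (b₀ ^_)) (s ℕ.+ n)                ≈⟨ ∏[1-X]-geometric b₀ c n ⟩
      Vector.foldr _*_ (b₀ ^ n) (λ j → b₀ - c j)   ∎

-- Binomial and multinomial coefficients, and weights of exponent vectors.

shuffles : ℕ → ℕ → ℕ
shuffles k l = (k ℕ.+ l) C k

shuffles*k!*l!≡[k+l]! : ∀ k l → shuffles k l ℕ.* (k ! ℕ.* l !) ≡ (k ℕ.+ l) !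
shuffles*k!*l!≡[k+l]! k l = begin
  shuffles k l ℕ.* (k ! ℕ.* l !)
    ≡⟨ ≡.cong (λ x → shuffles k l ℕ.* (k ! ℕ.* x !)) (ℕ.m+n∸m≡n k l) ⟨
  shuffles k l ℕ.* (k ! ℕ.* (k ℕ.+ l ℕ.∸ k) !)
    ≡⟨ ≡.cong (ℕ._* (k ! ℕ.* (k ℕ.+ l ℕ.∸ k) !)) (nCk≡n!/k![n-k]! (ℕ.m≤m+n k l)) ⟩
  _ ≡⟨ ℕ.m/n*n≡m {{k !* (k ℕ.+ l ℕ.∸ k) !≢0}} (k![n∸k]!∣n! (ℕ.m≤m+n k l)) ⟩
  (k ℕ.+ l) !  ∎
  where open ≡.≡-Reasoning

shuffles-k-0 : ∀ k → shuffles k 0 ≡ 1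
shuffles-k-0 k = ≡.trans (≡.cong (_C k) (ℕ.+-identityʳ k)) (nCn≡1 k)

shuffles-0-l : ∀ l → shuffles 0 l ≡ 1
shuffles-0-l l = ≡.trans (nCk≡nC[n∸k] {k = 0} {n = l} z≤n) (nCn≡1 l)

-- With binomials indexed by their two parts, each summand lowers exactly one part. This is the form
-- in which the rule enters `term-lower`.
pascal : ∀ k l → shuffles (suc k) (suc l) ≡ shuffles k (suc l) ℕ.+ shuffles (suc k) l
pascal k l = ≡.trans (≡.sym (nCk+nC[k+1]≡[n+1]C[k+1] (k ℕ.+ suc l) k))
  (≡.cong (λ n → shuffles k (suc l) ℕ.+ (n C suc k)) (ℕ.+-suc k l))

-- The multinomial coefficient without division: place the copies of the first variable among all
-- positions, then arrange the remaining variables.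
binomials : ∀ {m} → Vec ℕ m → ℕ
binomials []      = 1
binomials (k ∷ a) = shuffles k (Vec.sum a) ℕ.* binomials a

binomials*factorials : ∀ {m} (a : Vec ℕ m) → binomials a ℕ.* factorials a ≡ Vec.sum a !
binomials*factorials []      = ≡.refl
binomials*factorials (k ∷ a) = begin
  n ℕ.* b ℕ.* (k ! ℕ.* f)            ≡⟨ rearrange n b (k !) f ⟩
  n ℕ.* (k ! ℕ.* (b ℕ.* f))          ≡⟨ ≡.cong (λ x → n ℕ.* (k ! ℕ.* x)) (binomials*factorials a) ⟩
  n ℕ.* (k ! ℕ.* Vec.sum a !)        ≡⟨ shuffles*k!*l!≡[k+l]! k (Vec.sum a) ⟩
  (k ℕ.+ Vec.sum a) !                ∎
  where
  open ≡.≡-Reasoning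
  open +-*-Solver
  b f n : ℕ
  b = binomials a
  f = factorials a
  n = shuffles k (Vec.sum a)
  rearrange : ∀ n b k f → n ℕ.* b ℕ.* (k ℕ.* f) ≡ n ℕ.* (k ℕ.* (b ℕ.* f))
  rearrange = solve 4 (λ n b k f → n :* b :* (k :* f) := n :* (k :* (b :* f))) ≡.refl

multinomial≡binomials : ∀ {m} (a : Vec ℕ m) → multinomial a ≡ binomials a
multinomial≡binomials a = ≡.trans
  (ℕ./-congˡ {{factorials≢0 a}} (≡.sym (binomials*factorials a)))
  (ℕ.m*n/n≡m (binomials a) (factorials a) {{factorials≢0 a}})

-- The weight is the case `w = suc`. General `w` is needed for induction on the vector, because the
-- tail carries the weights `w ∘ suc`.
weighted : ∀ {m} → (ℕ → ℕ) → Vec ℕ m → ℕ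
weighted {m} w a = Vec.sum (Vec.tabulate λ (i : Fin m) → w (toℕ i) ℕ.* Vec.lookup a i)

weighted-∷ʳ : ∀ {m} w (a : Vec ℕ m) k → weighted w (a ∷ʳ k) ≡ weighted w a ℕ.+ w m ℕ.* k
weighted-∷ʳ w []      k = ℕ.+-identityʳ (w 0 ℕ.* k)
weighted-∷ʳ {suc m} w (x ∷ a) k = ≡.trans (≡.cong (w 0 ℕ.* x ℕ.+_) (weighted-∷ʳ (w ∘ suc) a k))
  (≡.sym (ℕ.+-assoc (w 0 ℕ.* x) (weighted (w ∘ suc) a) (w (suc m) ℕ.* k)))

weighted≡0 : ∀ {m} w (a : Vec ℕ m) → Vec.sum a ≡ 0 → weighted w a ≡ 0
weighted≡0 w []         eq = ≡.refl
weighted≡0 w (zero ∷ a) eq = ≡.cong₂ ℕ._+_ (ℕ.*-zeroʳ (w 0)) (weighted≡0 (w ∘ suc) a eq)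

sum-∷ʳ0 : ∀ {m} (a : Vec ℕ m) → Vec.sum (a ∷ʳ 0) ≡ Vec.sum a
sum-∷ʳ0 []      = ≡.refl
sum-∷ʳ0 (k ∷ a) = ≡.cong (k ℕ.+_) (sum-∷ʳ0 a)

-- The recurrence of the generalized Fibonacci polynomials: terms and their lowering.

module Fibonacci {c ℓ : Level} (R : CommutativeRing c ℓ) where
  open CommutativeRing R hiding (zero)
  open import Algebra.Definitions.RawSemiring (CommutativeSemiring.rawSemiring commutativeSemiring)
    using (_^_; product) renaming (_×_ to _·_)
  open import Algebra.Properties.Semiring.Sum semiring
    using (sum; sum-cong-≋; ∑-distrib-+; ∑-comm; *-distribˡ-sum; sum-replicate-zero)
  open import Algebra.Properties.Semiring.Mult semiring
    using (×-congʳ; ×-congˡ; ×-homo-+; ×-assocˡ; ×-comm-*; ×-assoc-*)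
  open import Algebra.Solver.Ring.NaturalCoefficients.Default commutativeSemiring
    using (solve; _:+_; _:*_; _:=_)
  open Series R using (_⋆_; ⋆-cong-≤)
  open SetoidReasoning setoid

  -- From here to Fbox-suc, variables are indexed from 0: t 0 is the paper's t₁.
  monomial : ∀ {m} → (ℕ → Carrier) → Vec ℕ m → Carrier
  monomial {m} t a = product (λ (i : Fin m) → t (toℕ i) ^ Vec.lookup a i)

  term : ∀ {m} → (ℕ → Carrier) → Vec ℕ m → Carrier
  term t a = binomials a · monomial t a

  term-∷ : ∀ {m} t k (a : Vec ℕ m) →
           term t (k ∷ a) ≈ (shuffles k (Vec.sum a) · t 0 ^ k) * term (t ∘ suc) a
  term-∷ t k a = begin
    (n ℕ.* b) · (x * y)   ≈⟨ ×-assocˡ (x * y) n b ⟨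
    n · (b · (x * y))     ≈⟨ ×-congʳ n (×-comm-* b x y) ⟨
    n · (x * (b · y))     ≈⟨ ×-assoc-* n x (b · y) ⟨
    (n · x) * (b · y)     ∎
    where
    b n : ℕ
    b = binomials a
    n = shuffles k (Vec.sum a)
    x y : Carrier
    x = t 0 ^ k
    y = monomial (t ∘ suc) a

  term-∷ʳ0 : ∀ {m} t (a : Vec ℕ m) → term t (a ∷ʳ 0) ≈ term t a
  term-∷ʳ0 t []      = +-congʳ (*-identityˡ 1#)
  term-∷ʳ0 t (k ∷ a) = begin
    term t (k ∷ (a ∷ʳ 0))  ≈⟨ term-∷ t k (a ∷ʳ 0) ⟩
    (shuffles k (Vec.sum (a ∷ʳ 0)) · t 0 ^ k) * term (t ∘ suc) (a ∷ʳ 0)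
      ≈⟨ *-cong (×-congˡ (≡.cong (shuffles k) (sum-∷ʳ0 a))) (term-∷ʳ0 (t ∘ suc) a) ⟩
    (shuffles k (Vec.sum a) · t 0 ^ k) * term (t ∘ suc) a  ≈⟨ term-∷ t k a ⟨
    term t (k ∷ a)         ∎

  lowerHead : ∀ {m} → Carrier → (Vec ℕ (suc m) → Carrier) → Vec ℕ (suc m) → Carrier
  lowerHead x h (zero  ∷ a) = 0#
  lowerHead x h (suc k ∷ a) = x * h (k ∷ a)

  -- The sum of tᵢ h(a − eᵢ) over all i with aᵢ > 0.
  lower : ∀ {m} → (ℕ → Carrier) → (Vec ℕ m → Carrier) → Vec ℕ m → Carrier
  lower t h []      = 0#
  lower t h (k ∷ a) = lowerHead (t 0) h (k ∷ a) + lower (t ∘ suc) (h ∘ (k ∷_)) a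

  -- Lowering reaches only vectors whose sum is one less. In `term-lower` this fixes the binomial
  -- `shuffles k (Vec.sum a′)`, which can then be pulled out.
  lower-cong : ∀ {m} t (g h : Vec ℕ m → Carrier) a →
    (∀ a′ → suc (Vec.sum a′) ≡ Vec.sum a → g a′ ≈ h a′) → lower t g a ≈ lower t h a
  lower-cong t g h []      eq = refl
  lower-cong t g h (k ∷ a) eq = +-cong (head k eq)
    (lower-cong (t ∘ suc) (g ∘ (k ∷_)) (h ∘ (k ∷_)) a λ a′ e →
      eq (k ∷ a′) (≡.trans (≡.sym (ℕ.+-suc k (Vec.sum a′))) (≡.cong (k ℕ.+_) e)))
    where
    head : ∀ k → (∀ a′ → suc (Vec.sum a′) ≡ Vec.sum (k ∷ a) → g a′ ≈ h a′) →
           lowerHead (t 0) g (k ∷ a) ≈ lowerHead (t 0) h (k ∷ a)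
    head zero    eq = refl
    head (suc k) eq = *-congˡ (eq (k ∷ a) ≡.refl)

  lower-*ˡ : ∀ {m} t x (h : Vec ℕ m → Carrier) a → lower t (λ a′ → x * h a′) a ≈ x * lower t h a
  lower-*ˡ t x h []      = sym (zeroʳ x)
  lower-*ˡ t x h (k ∷ a) = trans (+-cong (head k) (lower-*ˡ (t ∘ suc) x (h ∘ (k ∷_)) a))
    (sym (distribˡ x (lowerHead (t 0) h (k ∷ a)) (lower (t ∘ suc) (h ∘ (k ∷_)) a)))
    where
    head : ∀ k → lowerHead (t 0) (λ a′ → x * h a′) (k ∷ a) ≈ x * lowerHead (t 0) h (k ∷ a)
    head zero    = sym (zeroʳ x)
    head (suc k) = solve 3 (λ t x y → t :* (x :* y) := x :* (t :* y)) refl (t 0) x (h (k ∷ a))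

  lower≈0 : ∀ {m} t (h : Vec ℕ m → Carrier) a → Vec.sum a ≡ 0 → lower t h a ≈ 0#
  lower≈0 t h []         eq = refl
  lower≈0 t h (zero ∷ a) eq = trans (+-identityˡ _) (lower≈0 (t ∘ suc) (h ∘ (0 ∷_)) a eq)

  -- Pascal's rule for multinomial coefficients.
  term-lower : ∀ {m} t (a : Vec ℕ m) s → Vec.sum a ≡ suc s → term t a ≈ lower t (term t) a
  term-lower {suc m} t (k ∷ a) s eq = cases k (Vec.sum a) ≡.refl eq
    where
    u : Carrier
    u = term (t ∘ suc) a

    cases : ∀ k l → Vec.sum a ≡ l → k ℕ.+ l ≡ suc s → term t (k ∷ a) ≈ lower t (term t) (k ∷ a)
    -- All remaining exponents are 0, so only the first variable can be lowered, and both binomials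
    -- are 1.
    cases (suc k) zero sum≡ _ = begin
      term t (suc k ∷ a)                             ≈⟨ term-∷ t (suc k) a ⟩
      (shuffles (suc k) (Vec.sum a) · (t 0 * t 0 ^ k)) * u ≈⟨ *-congʳ (unit (suc k) (t 0 * t 0 ^ k)) ⟩
      t 0 * t 0 ^ k * u                              ≈⟨ *-assoc (t 0) (t 0 ^ k) u ⟩
      t 0 * (t 0 ^ k * u)                            ≈⟨ *-congˡ (*-congʳ (unit k (t 0 ^ k))) ⟨
      t 0 * ((shuffles k (Vec.sum a) · t 0 ^ k) * u)  ≈⟨ *-congˡ (term-∷ t k a) ⟨
      t 0 * term t (k ∷ a)                           ≈⟨ +-identityʳ _ ⟨
      t 0 * term t (k ∷ a) + 0#                      ≈⟨ +-congˡ (lower≈0 (t ∘ suc) _ a sum≡) ⟨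
      lower t (term t) (suc k ∷ a)                   ∎
      where
      unit : ∀ k x → shuffles k (Vec.sum a) · x ≈ x
      unit k x = trans (×-congˡ (≡.trans (≡.cong (shuffles k) sum≡) (shuffles-k-0 k)))
        (+-identityʳ x)
    -- Pascal's rule splits the binomial: one part accounts for lowering the first variable, the
    -- other, `shuffles k l`, for lowering the tail by the induction hypothesis.
    cases k (suc l) sum≡ _ = begin
      term t (k ∷ a)                                          ≈⟨ term-∷ t k a ⟩
      (shuffles k (Vec.sum a) · t 0 ^ k) * u                   ≈⟨ *-congʳ (×-congˡ (≡.cong (shuffles k) sum≡)) ⟩
      (shuffles k (suc l) · t 0 ^ k) * u                       ≈⟨ split k ⟩
      lowerHead (t 0) (term t) (k ∷ a) + x * u                ≈⟨ +-congˡ (*-congˡ (term-lower (t ∘ suc) a l sum≡)) ⟩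
      lowerHead (t 0) (term t) (k ∷ a) + x * lower (t ∘ suc) (term (t ∘ suc)) a
        ≈⟨ +-congˡ (lower-*ˡ (t ∘ suc) x (term (t ∘ suc)) a) ⟨
      lowerHead (t 0) (term t) (k ∷ a) + lower (t ∘ suc) (λ a′ → x * term (t ∘ suc) a′) a
        ≈⟨ +-congˡ (lower-cong (t ∘ suc) _ _ a λ a′ e → trans (term-∷ t k a′)
             (*-congʳ (×-congˡ (≡.cong (shuffles k) (ℕ.suc-injective (≡.trans e sum≡)))))) ⟨
      lower t (term t) (k ∷ a)                                ∎
      where
      x : Carrier
      x = shuffles k l · t 0 ^ k
      split : ∀ k → (shuffles k (suc l) · t 0 ^ k) * u ≈
                    lowerHead (t 0) (term t) (k ∷ a) + (shuffles k l · t 0 ^ k) * u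
      split zero    = trans
        (*-congʳ (×-congˡ (≡.trans (shuffles-0-l (suc l)) (≡.sym (shuffles-0-l l))))) (sym (+-identityˡ _))
      split (suc k) = begin
        (shuffles (suc k) (suc l) · y) * u                       ≈⟨ *-congʳ (×-congˡ (pascal k l)) ⟩
        ((shuffles k (suc l) ℕ.+ shuffles (suc k) l) · y) * u   ≈⟨ *-congʳ (×-homo-+ y (shuffles k (suc l)) _) ⟩
        (shuffles k (suc l) · y + shuffles (suc k) l · y) * u   ≈⟨ distribʳ u _ _ ⟩
        (shuffles k (suc l) · y) * u + (shuffles (suc k) l · y) * u
          ≈⟨ +-congʳ (trans (*-congʳ (sym (×-comm-* (shuffles k (suc l)) (t 0) (t 0 ^ k)))) (*-assoc (t 0) _ u)) ⟩
        t 0 * ((shuffles k (suc l) · t 0 ^ k) * u) + (shuffles (suc k) l · y) * u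
          ≈⟨ +-congʳ (*-congˡ (trans (term-∷ t k a) (*-congʳ (×-congˡ (≡.cong (shuffles k) sum≡))))) ⟨
        t 0 * term t (k ∷ a) + (shuffles (suc k) l · y) * u    ∎
        where
        y : Carrier
        y = t 0 ^ suc k

  -- Finite sums, and sums over boxes of exponent vectors.

  sum-tail : ∀ (g : ℕ → Carrier) B → g 0 ≈ 0# → g B ≈ 0# →
             sum {B} (g ∘ toℕ) ≈ sum {B} (g ∘ suc ∘ toℕ)
  sum-tail g B g0≈0 gB≈0 = begin
    sum {B} (g ∘ toℕ)              ≈⟨ +-identityʳ _ ⟨
    sum {B} (g ∘ toℕ) + 0#         ≈⟨ +-congˡ gB≈0 ⟨
    sum {B} (g ∘ toℕ) + g B        ≈⟨ ends g B ⟩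
    g 0 + sum {B} (g ∘ suc ∘ toℕ)  ≈⟨ +-congʳ g0≈0 ⟩
    0# + sum {B} (g ∘ suc ∘ toℕ)   ≈⟨ +-identityˡ _ ⟩
    sum {B} (g ∘ suc ∘ toℕ)        ∎
    where
    ends : ∀ g B → sum {B} (g ∘ toℕ) + g B ≈ g 0 + sum {B} (g ∘ suc ∘ toℕ)
    ends g zero    = +-comm 0# (g 0)
    ends g (suc B) = trans (+-assoc (g 0) _ (g (suc B))) (+-congˡ (ends (g ∘ suc) B))

  sum≈0 : ∀ {B} (g : Fin B → Carrier) → (∀ k → g k ≈ 0#) → sum g ≈ 0#
  sum≈0 {B} g eq = trans (sum-cong-≋ eq) (sum-replicate-zero B)

  sum-truncate : ∀ (g : ℕ → Carrier) {B B′} → B ℕ.≤ B′ → (∀ k → B ℕ.≤ k → g k ≈ 0#) →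
                 sum {B′} (g ∘ toℕ) ≈ sum {B} (g ∘ toℕ)
  sum-truncate g {B′ = B′} z≤n eq = sum≈0 {B′} (g ∘ toℕ) (λ k → eq (toℕ k) z≤n)
  sum-truncate g (s≤s B≤B′) eq =
    +-congˡ (sum-truncate (g ∘ suc) B≤B′ (λ k B≤k → eq (suc k) (s≤s B≤k)))

  box : ℕ → ∀ m → (Vec ℕ m → Carrier) → Carrier
  box B zero    h = h []
  box B (suc m) h = sum {B} (λ k → box B m (λ a → h (toℕ k ∷ a)))

  box-cong : ∀ B m {g h : Vec ℕ m → Carrier} → (∀ a → g a ≈ h a) → box B m g ≈ box B m h
  box-cong B zero    eq = eq []
  box-cong B (suc m) eq = sum-cong-≋ λ (k : Fin B) → box-cong B m (λ a → eq (toℕ k ∷ a))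

  box-+ : ∀ B m (g h : Vec ℕ m → Carrier) → box B m (λ a → g a + h a) ≈ box B m g + box B m h
  box-+ B zero    g h = refl
  box-+ B (suc m) g h = trans
    (sum-cong-≋ λ (k : Fin B) → box-+ B m (g ∘ (toℕ k ∷_)) (h ∘ (toℕ k ∷_)))
    (∑-distrib-+ {B} (λ k → box B m (g ∘ (toℕ k ∷_))) (λ k → box B m (h ∘ (toℕ k ∷_))))

  box-*ˡ : ∀ B m x (h : Vec ℕ m → Carrier) → box B m (λ a → x * h a) ≈ x * box B m h
  box-*ˡ B zero    x h = refl
  box-*ˡ B (suc m) x h = trans
    (sum-cong-≋ λ (k : Fin B) → box-*ˡ B m x (h ∘ (toℕ k ∷_)))
    (sym (*-distribˡ-sum {B} x (λ k → box B m (h ∘ (toℕ k ∷_)))))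

  box≈0 : ∀ B m {h : Vec ℕ m → Carrier} → (∀ a → h a ≈ 0#) → box B m h ≈ 0#
  box≈0 B zero    eq = eq []
  box≈0 B (suc m) eq = sum≈0 {B} _ (λ k → box≈0 B m (λ a → eq (toℕ k ∷ a)))

  -- The condition that makes the cut-off at `B` harmless: when every variable has weight at least
  -- 1, a single exponent of `B` or more already brings the weight to `B`.
  VanishesFrom : ℕ → (ℕ → Carrier) → Set ℓ
  VanishesFrom B φ = ∀ x → B ℕ.≤ x → φ x ≈ 0#

  vanishes-+ : ∀ {B φ} y → VanishesFrom B φ → VanishesFrom B (λ x → φ (y ℕ.+ x))
  vanishes-+ y φ≈0 x B≤x = φ≈0 (y ℕ.+ x) (ℕ.m≤n⇒m≤o+n y B≤x)

  -- Reindexing by a ↦ a + eᵢ raises the weight of a by wᵢ.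
  box-lower : ∀ B m (w : ℕ → ℕ) → (∀ i → 1 ℕ.≤ w i) →
    ∀ t (h : Vec ℕ m → Carrier) φ → VanishesFrom B φ →
    box B m (λ a → φ (weighted w a) * lower t h a) ≈
    sum {m} (λ i → t (toℕ i) * box B m (λ a → φ (w (toℕ i) ℕ.+ weighted w a) * h a))
  box-lower B zero    w 1≤w t h φ φ≈0 = zeroʳ (φ 0)
  box-lower B (suc m) w 1≤w t h φ φ≈0 = begin
    box B (suc m) (λ a → φ (weighted w a) * lower t h a)
      ≈⟨ box-cong B (suc m) split ⟩
    box B (suc m) (λ a → φ (weighted w a) * lowerHead (t 0) h a + φ (weighted w a) * lowerTail a)
      ≈⟨ box-+ B (suc m) (λ a → φ (weighted w a) * lowerHead (t 0) h a) (λ a → φ (weighted w a) * lowerTail a) ⟩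
    box B (suc m) (λ a → φ (weighted w a) * lowerHead (t 0) h a) +
    box B (suc m) (λ a → φ (weighted w a) * lowerTail a)
      ≈⟨ +-cong head tail ⟩
    t 0 * box B (suc m) (λ a → φ (w 0 ℕ.+ weighted w a) * h a) +
    sum {m} (λ i → t (suc (toℕ i)) * box B (suc m) (λ a → φ (w (suc (toℕ i)) ℕ.+ weighted w a) * h a)) ∎
    where
    w′ : ℕ → ℕ
    w′ = w ∘ suc
    lowerTail : Vec ℕ (suc m) → Carrier
    lowerTail (k ∷ a) = lower (t ∘ suc) (h ∘ (k ∷_)) a

    split : ∀ a → φ (weighted w a) * lower t h a ≈
                  φ (weighted w a) * lowerHead (t 0) h a + φ (weighted w a) * lowerTail a
    split (k ∷ a) = distribˡ (φ (weighted w (k ∷ a))) (lowerHead (t 0) h (k ∷ a)) (lowerTail (k ∷ a))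

    slice : ℕ → Carrier
    slice x = box B m (λ a → φ (w 0 ℕ.* x ℕ.+ weighted w′ a) * lowerHead (t 0) h (x ∷ a))

    -- Lowering the first exponent turns the range 1, ..., B into 0, ..., B - 1, while the box
    -- offers 0, ..., B - 1. The two ends are free: at 0 nothing can be lowered, and at B the weight
    -- reaches B, where `φ` vanishes.
    slice-last : slice B ≈ 0#
    slice-last = box≈0 B m λ a → trans (*-congʳ (φ≈0 _ (ℕ.m≤n⇒m≤n+o (weighted w′ a)
      (ℕ.m≤n*m B (w 0) {{ℕ.>-nonZero (1≤w 0)}})))) (zeroˡ _)

    slice-suc : ∀ x → slice (suc x) ≈
                t 0 * box B m (λ a → φ (w 0 ℕ.+ (w 0 ℕ.* x ℕ.+ weighted w′ a)) * h (x ∷ a))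
    slice-suc x = trans
      (box-cong B m λ a → trans
        (*-congʳ (reflexive (≡.cong φ (≡.trans (≡.cong (ℕ._+ weighted w′ a) (ℕ.*-suc (w 0) x))
                                                (ℕ.+-assoc (w 0) (w 0 ℕ.* x) (weighted w′ a))))))
        (solve 3 (λ p t h → p :* (t :* h) := t :* (p :* h)) refl _ (t 0) (h (x ∷ a))))
      (box-*ˡ B m (t 0) (λ a → φ (w 0 ℕ.+ (w 0 ℕ.* x ℕ.+ weighted w′ a)) * h (x ∷ a)))

    head : box B (suc m) (λ a → φ (weighted w a) * lowerHead (t 0) h a) ≈
           t 0 * box B (suc m) (λ a → φ (w 0 ℕ.+ weighted w a) * h a)
    head = begin
      sum {B} (slice ∘ toℕ)        ≈⟨ sum-tail slice B (box≈0 B m (λ a → zeroʳ _)) slice-last ⟩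
      sum {B} (slice ∘ suc ∘ toℕ)  ≈⟨ sum-cong-≋ (λ (k : Fin B) → slice-suc (toℕ k)) ⟩
      sum {B} (λ k → t 0 * box B m (λ a → φ (w 0 ℕ.+ (w 0 ℕ.* toℕ k ℕ.+ weighted w′ a)) * h (toℕ k ∷ a)))
        ≈⟨ *-distribˡ-sum {B} (t 0) _ ⟨
      t 0 * box B (suc m) (λ a → φ (w 0 ℕ.+ weighted w a) * h a)  ∎

    swap : ∀ x y z → x ℕ.+ (y ℕ.+ z) ≡ y ℕ.+ (x ℕ.+ z)
    swap = let open +-*-Solver renaming (_:+_ to _⊕_; _:=_ to _⊜_; solve to solveℕ) in
      solveℕ 3 (λ x y z → x ⊕ (y ⊕ z) ⊜ y ⊕ (x ⊕ z)) ≡.refl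

    -- For a fixed first exponent, its weight is absorbed into `φ` and the induction hypothesis
    -- applies to the other variables; then the two sums are exchanged.
    tail : box B (suc m) (λ a → φ (weighted w a) * lowerTail a) ≈
           sum {m} (λ i → t (suc (toℕ i)) * box B (suc m) (λ a → φ (w (suc (toℕ i)) ℕ.+ weighted w a) * h a))
    tail = begin
      sum {B} (λ k → box B m (λ a →
        φ (w 0 ℕ.* toℕ k ℕ.+ weighted w′ a) * lower (t ∘ suc) (h ∘ (toℕ k ∷_)) a))
        ≈⟨ sum-cong-≋ (λ (k : Fin B) → box-lower B m w′ (1≤w ∘ suc) (t ∘ suc) (h ∘ (toℕ k ∷_))
             (λ x → φ (w 0 ℕ.* toℕ k ℕ.+ x)) (vanishes-+ (w 0 ℕ.* toℕ k) φ≈0)) ⟩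
      sum {B} (λ k → sum {m} (λ i → t (suc (toℕ i)) *
        box B m (λ a → φ (w 0 ℕ.* toℕ k ℕ.+ (w′ (toℕ i) ℕ.+ weighted w′ a)) * h (toℕ k ∷ a))))
        ≈⟨ ∑-comm {B} {m} _ ⟩
      sum {m} (λ i → sum {B} (λ k → t (suc (toℕ i)) *
        box B m (λ a → φ (w 0 ℕ.* toℕ k ℕ.+ (w′ (toℕ i) ℕ.+ weighted w′ a)) * h (toℕ k ∷ a))))
        ≈⟨ sum-cong-≋ (λ (i : Fin m) → trans (sym (*-distribˡ-sum {B} (t (suc (toℕ i))) _))
             (*-congˡ (sum-cong-≋ λ (k : Fin B) → box-cong B m λ a →
               *-congʳ (reflexive (≡.cong φ (swap (w 0 ℕ.* toℕ k) (w′ (toℕ i)) (weighted w′ a))))))) ⟩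
      sum {m} (λ i → t (suc (toℕ i)) * box B (suc m) (λ a → φ (w (suc (toℕ i)) ℕ.+ weighted w a) * h a)) ∎

  box-shrink : ∀ {B B′} m (w : ℕ → ℕ) → (∀ i → 1 ℕ.≤ w i) → ∀ (h : Vec ℕ m → Carrier) φ →
    B ℕ.≤ B′ → VanishesFrom B φ →
    box B′ m (λ a → φ (weighted w a) * h a) ≈ box B m (λ a → φ (weighted w a) * h a)
  box-shrink zero w 1≤w h φ B≤B′ φ≈0 = refl
  box-shrink {B} {B′} (suc m) w 1≤w h φ B≤B′ φ≈0 = trans
    (sum-cong-≋ λ (k : Fin B′) → box-shrink m (w ∘ suc) (1≤w ∘ suc) (h ∘ (toℕ k ∷_))
      (λ x → φ (w 0 ℕ.* toℕ k ℕ.+ x)) B≤B′ (vanishes-+ (w 0 ℕ.* toℕ k) φ≈0))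
    (sum-truncate (λ k → box B m (λ a → φ (weighted w (k ∷ a)) * h (k ∷ a))) B≤B′ λ k B≤k →
      box≈0 B m λ a → trans (*-congʳ (φ≈0 _ (ℕ.m≤n⇒m≤n+o (weighted (w ∘ suc) a)
        (ℕ.≤-trans B≤k (ℕ.m≤n*m k (w 0) {{ℕ.>-nonZero (1≤w 0)}}))))) (zeroˡ _))

  box-drop-last : ∀ B m (g : Vec ℕ (suc m) → Carrier) (h : Vec ℕ m → Carrier) →
    (∀ a → g (a ∷ʳ 0) ≈ h a) → (∀ a k → g (a ∷ʳ suc k) ≈ 0#) → box (suc B) (suc m) g ≈ box (suc B) m h
  box-drop-last B zero    g h eq₀ eqₛ =
    trans (+-cong (eq₀ []) (sum≈0 {B} _ (λ k → eqₛ [] (toℕ k)))) (+-identityʳ _)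
  box-drop-last B (suc m) g h eq₀ eqₛ = sum-cong-≋ λ (k : Fin (suc B)) →
    box-drop-last B m (g ∘ (toℕ k ∷_)) (h ∘ (toℕ k ∷_)) (λ a → eq₀ (toℕ k ∷ a)) (λ a → eqₛ (toℕ k ∷ a))

  -- Fibonacci polynomials as sums over boxes, and their recurrence.

  indicator : ℕ → ℕ → Carrier
  indicator n x = if x ℕ.≡ᵇ n then 1# else 0#

  indicator≈0 : ∀ n → VanishesFrom (suc n) (indicator n)
  indicator≈0 zero    (suc x) 1≤x       = refl
  indicator≈0 (suc n) (suc x) (s≤s n<x) = indicator≈0 n x n<x

  -- Fₙ as a sum over {0,…,B−1}ᵐ, the same for all B > n and m ≥ n: the recurrence
  -- needs F₀, …, Fₙ summed over one common box.
  Fbox : ℕ → ℕ → (ℕ → Carrier) → ℕ → Carrier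
  Fbox B m t n = box B m (λ a → indicator n (weighted suc a) * term t a)

  Fbox-shrink : ∀ {B} m t n → n ℕ.< B → Fbox B m t n ≈ Fbox (suc n) m t n
  Fbox-shrink m t n n<B = box-shrink m suc (λ _ → s≤s z≤n) (term t) (indicator n) n<B (indicator≈0 n)

  -- The last of m + 1 variables has weight m + 1 > n, so a positive exponent there makes the
  -- indicator vanish.
  Fbox-drop-last : ∀ B m t n → n ℕ.≤ m → Fbox (suc B) (suc m) t n ≈ Fbox (suc B) m t n
  Fbox-drop-last B m t n n≤m = box-drop-last B m
    (λ a → indicator n (weighted suc a) * term t a) (λ a → indicator n (weighted suc a) * term t a)
    (λ a → *-cong (reflexive (≡.cong (indicator n) (≡.trans (weighted-∷ʳ suc a 0)
                    (≡.trans (≡.cong (weighted suc a ℕ.+_) (ℕ.*-zeroʳ m)) (ℕ.+-identityʳ _)))))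
                  (term-∷ʳ0 t a))
    (λ a k → trans (*-congʳ (indicator≈0 n _ (ℕ.≤-trans (s≤s n≤m)
        (≡.subst (suc m ℕ.≤_) (≡.sym (weighted-∷ʳ suc a (suc k)))
          (ℕ.m≤n⇒m≤o+n (weighted suc a) (ℕ.m≤m*n (suc m) (suc k)))))))
      (zeroˡ (term t (a ∷ʳ suc k))))

  Fbox-drop : ∀ B m d t n → n ℕ.≤ m → Fbox (suc B) (d ℕ.+ m) t n ≈ Fbox (suc B) m t n
  Fbox-drop B m zero    t n n≤m = refl
  Fbox-drop B m (suc d) t n n≤m = trans
    (Fbox-drop-last B (d ℕ.+ m) t n (ℕ.m≤n⇒m≤o+n d n≤m)) (Fbox-drop B m d t n n≤m)

  Fbox-stable : ∀ {B m} t n → n ℕ.< B → n ℕ.≤ m → Fbox B m t n ≈ Fbox (suc n) n t n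
  Fbox-stable {B} {m} t n n<B n≤m = begin
    Fbox B m t n                        ≈⟨ Fbox-shrink m t n n<B ⟩
    Fbox (suc n) m t n                  ≡⟨ ≡.cong (λ m → Fbox (suc n) m t n) (≡.sym (ℕ.m∸n+n≡m n≤m)) ⟩
    Fbox (suc n) (m ℕ.∸ n ℕ.+ n) t n    ≈⟨ Fbox-drop n n (m ℕ.∸ n) t n ℕ.≤-refl ⟩
    Fbox (suc n) n t n                  ∎

  -- A vector of weight n + 1 has positive sum, so its term expands by lowering each variable in
  -- turn. Reindexing gives sums of smaller weight over the same box, which stability identifies
  -- with the Fₖ for k ≤ n.
  Fbox-suc : ∀ t n → Fbox (suc (suc n)) (suc n) t (suc n) ≈ (t ⋆ λ k → Fbox (suc k) k t k) n
  Fbox-suc t n = begin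
    box B m (λ a → indicator (suc n) (weighted suc a) * term t a)
      ≈⟨ box-cong B m expand ⟩
    box B m (λ a → indicator (suc n) (weighted suc a) * lower t (term t) a)
      ≈⟨ box-lower B m suc (λ _ → s≤s z≤n) t (term t) (indicator (suc n)) (indicator≈0 (suc n)) ⟩
    sum {m} (λ i → t (toℕ i) * shifted (toℕ i) n)
      ≈⟨ convolution m n t ℕ.≤-refl ⟩
    (t ⋆ shifted 0) n
      ≈⟨ ⋆-cong-≤ n (λ _ _ → refl)
           (λ k k≤n → Fbox-stable t k (s≤s (ℕ.m≤n⇒m≤1+n k≤n)) (ℕ.m≤n⇒m≤1+n k≤n)) ⟩
    (t ⋆ λ k → Fbox (suc k) k t k) n ∎
    where
    B m : ℕ
    B = suc (suc n)
    m = suc n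

    expand : ∀ a → indicator (suc n) (weighted suc a) * term t a ≈
                   indicator (suc n) (weighted suc a) * lower t (term t) a
    expand a = cases (Vec.sum a) ≡.refl
      where
      cases : ∀ s → Vec.sum a ≡ s → indicator (suc n) (weighted suc a) * term t a ≈
                                    indicator (suc n) (weighted suc a) * lower t (term t) a
      cases zero    eq = trans (*-congʳ ind≈0) (trans (zeroˡ _) (sym (trans (*-congʳ ind≈0) (zeroˡ _))))
        where
        ind≈0 : indicator (suc n) (weighted suc a) ≈ 0#
        ind≈0 = reflexive (≡.cong (indicator (suc n)) (weighted≡0 suc a eq))
      cases (suc s) eq = *-congˡ (term-lower t a s eq)

    -- Since `≡ᵇ` strips successors from both sides, `shifted (suc i) (suc k)` computes to
    -- `shifted i k`. This matches the output of `box-lower` and drives the induction in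
    -- `convolution`, where the terms with i > k are 0.
    shifted : ℕ → ℕ → Carrier
    shifted i k = box B m (λ a → indicator k (i ℕ.+ weighted suc a) * term t a)

    convolution : ∀ M k u → k ℕ.< M →
      sum {M} (λ i → u (toℕ i) * shifted (toℕ i) k) ≈ (u ⋆ shifted 0) k
    convolution (suc M) zero    u _         = trans
      (+-congˡ (sum≈0 {M} _ λ i → trans (*-congˡ (box≈0 B m (λ a → zeroˡ (term t a)))) (zeroʳ _)))
      (+-identityʳ _)
    convolution (suc M) (suc k) u (s≤s k<M) = +-congˡ (convolution M k (u ∘ suc) k<M)

-- Divisors of prime powers.

∣p^n⇒≡p^i : ∀ {p} → Prime p → ∀ n {d} → d ∣ p ℕ.^ n → ∃ λ i → i ℕ.≤ n × d ≡ p ℕ.^ i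
∣p^n⇒≡p^i pp zero    d∣1 = 0 , z≤n , ∣1⇒≡1 d∣1
∣p^n⇒≡p^i {p} pp (suc n) {d} d∣p^1+n with p ∣? d
-- If p divides d, one factor p cancels on both sides; otherwise d is coprime to p and already
-- divides pⁿ.
... | yes (divides-refl q) with ∣p^n⇒≡p^i pp n (*-cancelˡ-∣ p {{prime⇒nonZero pp}}
                                (≡.subst (_∣ p ℕ.* p ℕ.^ n) (ℕ.*-comm q p) d∣p^1+n))
...   | i , i≤n , q≡p^i = suc i , s≤s i≤n , ≡.trans (ℕ.*-comm q p) (≡.cong (p ℕ.*_) q≡p^i)
∣p^n⇒≡p^i {p} pp (suc n) {d} d∣p^1+n | no p∤d with ∣p^n⇒≡p^i pp n (coprime-divisor coprime d∣p^1+n)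
  where
  coprime : Coprime d p
  coprime (e∣d , e∣p) with prime⇒irreducible pp e∣p
  ... | inj₁ e≡1    = e≡1
  ... | inj₂ ≡.refl with () ← p∤d e∣d
... | i , i≤n , d≡p^i = i , ℕ.m≤n⇒m≤1+n i≤n , d≡p^i

p^[n∸i]*p^i≡p^n : ∀ p {i n} → i ≤ n → p ℕ.^ (n ℕ.∸ i) ℕ.* p ℕ.^ i ≡ p ℕ.^ n
p^[n∸i]*p^i≡p^n p {i} {n} i≤n =
  ≡.trans (≡.sym (ℕ.^-distribˡ-+-* p (n ℕ.∸ i) i)) (≡.cong (p ℕ.^_) (ℕ.m∸n+n≡m i≤n))

-- A divisor d of pⁿ occurs in the definition of ⊛ as d − 1.
divisors-p^n : ∀ {p} → Prime p → ∀ n →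
  List.filter (λ k → suc k ∣? p ℕ.^ n) (List.upTo (p ℕ.^ n)) ↭
  List.applyUpTo (λ i → ℕ.pred (p ℕ.^ i)) (suc n)
-- Two lists without repetitions and with the same members are permutations of each other.
divisors-p^n {p} pp n = ∼bag⇒↭ (unique∧set⇒bag
  (Unique.filter⁺ (λ k → suc k ∣? p ℕ.^ n) (Unique.upTo⁺ (p ℕ.^ n)))
  (Unique.applyUpTo⁺₁ f (suc n) λ {i} {j} i<j _ eq → ℕ.<⇒≢ i<j (exponent-injective eq))
  (mk⇔ to from))
  where
  instance
    p≢0 : NonZero p
    p≢0 = prime⇒nonZero pp

  f : ℕ → ℕ
  f i = ℕ.pred (p ℕ.^ i)

  1+f : ∀ i → suc (f i) ≡ p ℕ.^ i
  1+f i = ℕ.suc-pred (p ℕ.^ i) {{ℕ.m^n≢0 p i}}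

  exponent-injective : ∀ {i j} → f i ≡ f j → i ≡ j
  exponent-injective {i} {j} eq = ℕ.≤-antisym (le i j p^i≡p^j) (le j i (≡.sym p^i≡p^j))
    where
    p^i≡p^j : p ℕ.^ i ≡ p ℕ.^ j
    p^i≡p^j = ≡.trans (≡.sym (1+f i)) (≡.trans (≡.cong suc eq) (1+f j))
    le : ∀ i j → p ℕ.^ i ≡ p ℕ.^ j → i ℕ.≤ j
    le i j e = ℕ.≮⇒≥ λ j<i →
      ℕ.<⇒≢ (ℕ.^-monoʳ-< p (ℕ.nonTrivial⇒n>1 p {{prime⇒nonTrivial pp}}) j<i) (≡.sym e)

  to : ∀ {k} → k ∈ List.filter (λ k → suc k ∣? p ℕ.^ n) (List.upTo (p ℕ.^ n)) →
       k ∈ List.applyUpTo f (suc n)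
  to k∈ with ∈-filter⁻ (λ k → suc k ∣? p ℕ.^ n) {xs = List.upTo (p ℕ.^ n)} k∈
  ... | _ , k∣ with ∣p^n⇒≡p^i pp n k∣
  ...   | i , i≤n , eq = ≡.subst (_∈ _) (≡.sym (≡.cong ℕ.pred eq)) (∈-applyUpTo⁺ f (s≤s i≤n))

  from : ∀ {k} → k ∈ List.applyUpTo f (suc n) →
         k ∈ List.filter (λ k → suc k ∣? p ℕ.^ n) (List.upTo (p ℕ.^ n))
  from k∈ with ∈-applyUpTo⁻ f k∈
  ... | i , s≤s i≤n , ≡.refl = ∈-filter⁺ (λ k → suc k ∣? p ℕ.^ n)
    (∈-upTo⁺ (ℕ.<-≤-trans (ℕ.≤-reflexive (1+f i)) (ℕ.^-monoʳ-≤ p i≤n)))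
    (≡.subst₂ _∣_ (≡.sym (1+f i)) (p^[n∸i]*p^i≡p^n p i≤n) (n∣m*n (p ℕ.^ (n ℕ.∸ i))))

-- Sums over lists of complex numbers, and the recurrence for `F`.

K : HeytingCommutativeRing 0ℓ 0ℓ 0ℓ
K = HeytingField.heytingCommutativeRing Complex.heytingField

R : CommutativeRing 0ℓ 0ℓ
R = HeytingCommutativeRing.commutativeRing K

open HeytingField Complex.heytingField hiding (zero)
open CommutativeRing R using (ring; semiring; commutativeSemiring)
open import Algebra.Definitions.RawSemiring (CommutativeSemiring.rawSemiring commutativeSemiring)
  using () renaming (_×_ to _·_)
open import Algebra.Properties.Ring ring using (-‿distribˡ-*; -‿+-comm)
open import Algebra.Properties.Semiring.Mult semiring using (×-congˡ)
open import Algebra.Properties.Semiring.Sum semiring using (sum)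
open import Algebra.Apartness.Properties.HeytingCommutativeRing K using (#-congʳ; #-congˡ)
open Series R
open NonVanishing K
open Fibonacci R
module ≈ = SetoidReasoning (CommutativeRing.setoid R)

∑-cong : {A : Set} (xs : List A) {f g : A → ℂ} → (∀ x → f x ≈ g x) → ∑ xs f ≈ ∑ xs g
∑-cong []       eq = refl
∑-cong (x ∷ xs) eq = +-cong (eq x) (∑-cong xs eq)

∑-↭ : {A : Set} {xs ys : List A} (f : A → ℂ) → xs ↭ ys → ∑ xs f ≈ ∑ ys f
∑-↭ f ↭.refl           = refl
∑-↭ f (↭.prep x xs↭ys) = +-congˡ (∑-↭ f xs↭ys)
∑-↭ f (↭.swap {xs} {ys} x y xs↭ys) = trans (sym (+-assoc (f x) (f y) (∑ xs f)))
  (trans (+-cong (+-comm (f x) (f y)) (∑-↭ f xs↭ys)) (+-assoc (f y) (f x) (∑ ys f)))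
∑-↭ f (↭.trans p q)    = trans (∑-↭ f p) (∑-↭ f q)

∑-filter : {A : Set} {P : Pred A 0ℓ} (P? : Decidable P) (xs : List A) (f : A → ℂ) →
           ∑ (List.filter P? xs) f ≈ ∑ xs (λ x → (if does (P? x) then 1# else 0#) * f x)
∑-filter P? []       f = refl
∑-filter P? (x ∷ xs) f with does (P? x)
... | true  = +-cong (sym (*-identityˡ (f x))) (∑-filter P? xs f)
... | false = trans (sym (+-identityˡ _)) (+-cong (sym (zeroˡ (f x))) (∑-filter P? xs f))

∑-++ : {A : Set} (xs ys : List A) (f : A → ℂ) → ∑ (xs ++ ys) f ≈ ∑ xs f + ∑ ys f
∑-++ []       ys f = sym (+-identityˡ (∑ ys f))
∑-++ (x ∷ xs) ys f = trans (+-congˡ (∑-++ xs ys f)) (sym (+-assoc (f x) (∑ xs f) (∑ ys f)))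

∑-map : {A B : Set} (h : A → B) (xs : List A) (f : B → ℂ) → ∑ (List.map h xs) f ≈ ∑ xs (f ∘ h)
∑-map h []       f = refl
∑-map h (x ∷ xs) f = +-congˡ (∑-map h xs f)

∑-cartesianProductWith : {A B C : Set} (h : A → B → C) (xs : List A) (ys : List B) (f : C → ℂ) →
  ∑ (List.cartesianProductWith h xs ys) f ≈ ∑ xs (λ x → ∑ ys (λ y → f (h x y)))
∑-cartesianProductWith h []       ys f = refl
∑-cartesianProductWith h (x ∷ xs) ys f = trans (∑-++ (List.map (h x) ys) _ f)
  (+-cong (∑-map (h x) ys f) (∑-cartesianProductWith h xs ys f))

∑-applyUpTo : ∀ (h : ℕ → ℕ) n (f : ℕ → ℂ) → ∑ (List.applyUpTo h n) f ≈ sum {n} (λ i → f (h (toℕ i)))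
∑-applyUpTo h zero    f = refl
∑-applyUpTo h (suc n) f = +-congˡ (∑-applyUpTo (h ∘ suc) n f)

∑-vectors : ∀ B m (f : Vec ℕ m → ℂ) → ∑ (vectors (List.upTo B) m) f ≈ box B m f
∑-vectors B zero    f = +-identityʳ (f [])
∑-vectors B (suc m) f = begin
  ∑ (vectors (List.upTo B) (suc m)) f
    ≈⟨ ∑-cartesianProductWith _∷_ (List.upTo B) (vectors (List.upTo B) m) f ⟩
  ∑ (List.upTo B) (λ k → ∑ (vectors (List.upTo B) m) (λ a → f (k ∷ a)))
    ≈⟨ ∑-cong (List.upTo B) (λ k → ∑-vectors B m (λ a → f (k ∷ a))) ⟩
  ∑ (List.upTo B) (λ k → box B m (λ a → f (k ∷ a)))
    ≈⟨ ∑-applyUpTo id B (λ k → box B m (λ a → f (k ∷ a))) ⟩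
  box B (suc m) f ∎
  where open ≈

-- The filter in `exponents` becomes a factor 0 or 1, which agrees by computation with `indicator`.
-- The shift `t ∘ suc` passes from variables indexed from 1 to variables indexed from 0.
F≈Fbox : ∀ n t → F n t ≈ Fbox (suc n) n (t ∘ suc) n
F≈Fbox n t = begin
  F n t
    ≈⟨ ∑-filter (λ a → weight a ℕ.≟ n) (vectors (List.upTo (suc n)) n) _ ⟩
  ∑ (vectors (List.upTo (suc n)) n) (λ a → indicator n (weight a) * (multinomial a · monomial (t ∘ suc) a))
    ≈⟨ ∑-cong (vectors (List.upTo (suc n)) n) (λ a → *-congˡ (×-congˡ (multinomial≡binomials a))) ⟩
  ∑ (vectors (List.upTo (suc n)) n) (λ a → indicator n (weight a) * term (t ∘ suc) a)
    ≈⟨ ∑-vectors (suc n) n _ ⟩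
  Fbox (suc n) n (t ∘ suc) n ∎
  where open ≈

F-zero : ∀ t → F 0 t ≈ 1#
F-zero t = trans (F≈Fbox 0 t) (trans (*-identityˡ _) (+-identityʳ 1#))

F-suc : ∀ t n → F (suc n) t ≈ (t ∘ suc ⋆ λ k → F k t) n
F-suc t n = begin
  F (suc n) t                                            ≈⟨ F≈Fbox (suc n) t ⟩
  Fbox (suc (suc n)) (suc n) (t ∘ suc) (suc n)           ≈⟨ Fbox-suc (t ∘ suc) n ⟩
  (t ∘ suc ⋆ λ k → Fbox (suc k) k (t ∘ suc) k) n         ≈⟨ ⋆-cong (λ _ → refl) (λ k → sym (F≈Fbox k t)) n ⟩
  (t ∘ suc ⋆ λ k → F k t) n                              ∎
  where open ≈

1-T : (ℕ → ℂ) → ℕ → ℂ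
1-T t zero    = 1#
1-T t (suc n) = - t (suc n)

⋆-negˡ : ∀ f g n → ((λ k → - f k) ⋆ g) n ≈ - (f ⋆ g) n
⋆-negˡ f g zero    = sym (-‿distribˡ-* (f 0) (g 0))
⋆-negˡ f g (suc n) = trans (+-cong (sym (-‿distribˡ-* (f 0) (g (suc n)))) (⋆-negˡ (f ∘ suc) g n))
  (-‿+-comm (f 0 * g (suc n)) ((f ∘ suc ⋆ g) n))

1-T⋆F : ∀ t → 1-T t ⋆ (λ n → F n t) ≋ ε
1-T⋆F t zero    = trans (*-identityˡ (F 0 t)) (F-zero t)
1-T⋆F t (suc n) = begin
  1# * F (suc n) t + ((λ k → - t (suc k)) ⋆ (λ n → F n t)) n
    ≈⟨ +-cong (*-identityˡ (F (suc n) t)) (⋆-negˡ (t ∘ suc) (λ n → F n t) n) ⟩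
  F (suc n) t + - (t ∘ suc ⋆ λ n → F n t) n                   ≈⟨ +-congʳ (F-suc t n) ⟩
  (t ∘ suc ⋆ λ n → F n t) n + - (t ∘ suc ⋆ λ n → F n t) n     ≈⟨ -‿inverseʳ _ ⟩
  0# ∎
  where open ≈

-- Bell series at p, and the type of a mixed product.

module _ {p : ℕ} (pp : Prime p) where

  private
    instance
      p≢0 : NonZero p
      p≢0 = prime⇒nonZero pp

  bell : Arithmetic → ℕ → ℂ
  bell α n = α (p ℕ.^ n)

  -- The divisors of pⁿ are the pⁱ with i ≤ n, with cofactors pⁿ⁻ⁱ, and sums do not depend on the
  -- order of the list.
  bell-⊛ : ∀ α β → bell (α ⊛ β) ≋ bell α ⋆ bell β
  bell-⊛ α β n = trans (∑-↭ G (divisors-p^n pp n))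
    (collect n (λ i → ℕ.pred (p ℕ.^ i)) (bell α) λ i i≤n → values i i≤n)
    where
    G : ℕ → ℂ
    G k = α (suc k) * β (p ℕ.^ n ℕ./ suc k)

    collect : ∀ m h f → (∀ i → i ℕ.≤ m → G (h i) ≈ f i * bell β (m ℕ.∸ i)) →
              ∑ (List.applyUpTo h (suc m)) G ≈ (f ⋆ bell β) m
    collect zero    h f eq = trans (+-identityʳ _) (eq 0 z≤n)
    collect (suc m) h f eq = +-cong (eq 0 z≤n) (collect m (h ∘ suc) (f ∘ suc) (λ i i≤m → eq (suc i) (s≤s i≤m)))

    values : ∀ i → i ℕ.≤ n → G (ℕ.pred (p ℕ.^ i)) ≈ bell α i * bell β (n ℕ.∸ i)
    values i i≤n = reflexive (≡.cong₂ (λ x y → α x * β y) 1+f quotient)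
      where
      instance
        p^i≢0 : NonZero (p ℕ.^ i)
        p^i≢0 = ℕ.m^n≢0 p i
      1+f : suc (ℕ.pred (p ℕ.^ i)) ≡ p ℕ.^ i
      1+f = ℕ.suc-pred (p ℕ.^ i)
      quotient : p ℕ.^ n ℕ./ suc (ℕ.pred (p ℕ.^ i)) ≡ p ℕ.^ (n ℕ.∸ i)
      quotient = ≡.trans (ℕ./-congʳ 1+f) (≡.trans
        (ℕ./-congˡ (≡.sym (p^[n∸i]*p^i≡p^n p i≤n)))
        (ℕ.m*n/n≡m (p ℕ.^ (n ℕ.∸ i)) (p ℕ.^ i)))

  bell-δ : bell δ ≋ ε
  bell-δ zero    = refl
  bell-δ (suc n) = reflexive (≡.cong (if_then 1# else 0#) (≢1 (p ℕ.^ suc n) 1<p^1+n))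
    where
    1<p^1+n : 1 ℕ.< p ℕ.^ suc n
    1<p^1+n = ℕ.<-≤-trans (ℕ.nonTrivial⇒n>1 p {{prime⇒nonTrivial pp}})
      (ℕ.m≤m*n p (p ℕ.^ n) {{ℕ.m^n≢0 p n}})
    ≢1 : ∀ m → 1 ℕ.< m → (m ℕ.≡ᵇ 1) ≡ false
    ≢1 (suc zero)    (s≤s ())
    ≢1 (suc (suc m)) _ = ≡.refl

  [1-X]-degreeOne : ∀ β (β₁ : IsDegreeOne p β) → [1- IsDegreeOne.base β₁ X] bell β ≋ ε
  [1-X]-degreeOne β β₁ n =
    trans ([1-X]-cong refl (IsDegreeOne.powers β₁) n) ([1-X]-geometric (IsDegreeOne.base β₁) n)

  -- The factor 1 - cX inverts the geometric series of `γ`, and the Bell series of `γ` and `γ⁻¹`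
  -- multiply to 1.
  bell-inverse : ∀ γ γ⁻¹ (γ₁ : IsDegreeOne p γ) → γ⁻¹ IsInverseOf γ →
                  bell γ⁻¹ ≋ [1- IsDegreeOne.base γ₁ X] ε
  bell-inverse γ γ⁻¹ γ₁ inverse n = begin
    bell γ⁻¹ n                                ≈⟨ ⋆-identityˡ (bell γ⁻¹) n ⟨
    (ε ⋆ bell γ⁻¹) n                          ≈⟨ ⋆-cong ([1-X]-degreeOne γ γ₁) (λ _ → refl) n ⟨
    (([1- c X] bell γ) ⋆ bell γ⁻¹) n         ≈⟨ [1-X]-⋆ˡ c (bell γ) (bell γ⁻¹) n ⟩
    ([1- c X] (bell γ ⋆ bell γ⁻¹)) n         ≈⟨ [1-X]-cong refl product≈ε n ⟩
    ([1- c X] ε) n                             ∎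
    where
    open ≈
    c : ℂ
    c = IsDegreeOne.base γ₁
    product≈ε : bell γ ⋆ bell γ⁻¹ ≋ ε
    product≈ε k = trans (sym (bell-⊛ γ γ⁻¹ k)) (trans (inverse (p ℕ.^ k) {{ℕ.m^n≢0 p k}}) (bell-δ k))

  bell-⨂ : ∀ {r} (β : Fin (suc r) → Arithmetic) → bell (⨂ β) ≋ bell (β zero) ⋆ bell (⨂ (β ∘ suc))
  bell-⨂ β = bell-⊛ (β zero) (⨂ (β ∘ suc))

  -- The later linear factors move past the series of `β zero` and cancel the remaining product by
  -- induction; the first one then cancels `β zero`.
  ∏[1-X]-⨂ : ∀ {r} (β : Fin r → Arithmetic) (β₁ : ∀ i → IsDegreeOne p (β i)) →
             ∏[1- (λ i → IsDegreeOne.base (β₁ i)) X] bell (⨂ β) ≋ ε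
  ∏[1-X]-⨂ {zero}  β β₁ = bell-δ
  ∏[1-X]-⨂ {suc r} β β₁ n = begin
    ([1- b zero X] ∏[1- b ∘ suc X] bell (⨂ β)) n
      ≈⟨ [1-X]-cong refl (∏[1-X]-cong (b ∘ suc) (bell-⨂ β)) n ⟩
    ([1- b zero X] ∏[1- b ∘ suc X] (bell (β zero) ⋆ bell (⨂ (β ∘ suc)))) n
      ≈⟨ [1-X]-cong refl (∏[1-X]-⋆ʳ (b ∘ suc) (bell (β zero)) (bell (⨂ (β ∘ suc)))) n ⟨
    ([1- b zero X] (bell (β zero) ⋆ (∏[1- b ∘ suc X] bell (⨂ (β ∘ suc))))) n
      ≈⟨ [1-X]-cong refl (⋆-cong (λ _ → refl) (∏[1-X]-⨂ (β ∘ suc) (β₁ ∘ suc))) n ⟩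
    ([1- b zero X] (bell (β zero) ⋆ ε)) n
      ≈⟨ [1-X]-cong refl (⋆-identityʳ (bell (β zero))) n ⟩
    ([1- b zero X] bell (β zero)) n
      ≈⟨ [1-X]-degreeOne (β zero) (β₁ zero) n ⟩
    ε n ∎
    where
    open ≈
    b : Fin (suc r) → ℂ
    b i = IsDegreeOne.base (β₁ i)

  bell-⨂-inverse : ∀ {s} (γ γ⁻¹ : Fin s → Arithmetic) (γ₁ : ∀ j → IsDegreeOne p (γ j)) →
                    (∀ j → γ⁻¹ j IsInverseOf γ j) →
                    bell (⨂ γ⁻¹) ≋ ∏[1- (λ j → IsDegreeOne.base (γ₁ j)) X] ε
  bell-⨂-inverse {zero}  γ γ⁻¹ γ₁ inverse = bell-δ
  bell-⨂-inverse {suc s} γ γ⁻¹ γ₁ inverse n = begin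
    bell (⨂ γ⁻¹) n                                       ≈⟨ bell-⨂ γ⁻¹ n ⟩
    (bell (γ⁻¹ zero) ⋆ bell (⨂ (γ⁻¹ ∘ suc))) n
      ≈⟨ ⋆-cong (bell-inverse (γ zero) (γ⁻¹ zero) (γ₁ zero) (inverse zero))
                (bell-⨂-inverse (γ ∘ suc) (γ⁻¹ ∘ suc) (γ₁ ∘ suc) (inverse ∘ suc)) n ⟩
    (([1- c zero X] ε) ⋆ (∏[1- c ∘ suc X] ε)) n           ≈⟨ [1-X]-⋆ˡ (c zero) ε (∏[1- c ∘ suc X] ε) n ⟩
    ([1- c zero X] (ε ⋆ (∏[1- c ∘ suc X] ε))) n           ≈⟨ [1-X]-cong refl (⋆-identityˡ (∏[1- c ∘ suc X] ε)) n ⟩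
    (∏[1- c X] ε) n                                       ∎
    where
    open ≈
    c : Fin (suc s) → ℂ
    c j = IsDegreeOne.base (γ₁ j)

  -- The case n = 1 of `powers`. It carries the normal form condition, stated for values at p, over
  -- to the bases.
  base≈value : ∀ β (β₁ : IsDegreeOne p β) → IsDegreeOne.base β₁ ≈ β p
  base≈value β β₁ = trans (sym (*-identityʳ (IsDegreeOne.base β₁)))
    (trans (sym (IsDegreeOne.powers β₁ 1)) (reflexive (≡.cong β (ℕ.^-identityʳ p))))

  mixed⇒type4 : ∀ {r s} (α : Arithmetic) → IsLocallyNormalForm p (suc r) (suc s) α → IsType4 p α
  mixed⇒type4 {r} {s} α nf = record
    { values     = quotient-infinitelyMany b c (bell α) (IsDegreeOne.base#0 (β-degreeOne zero)) (b#c zero) P⋆α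
    -- P and Q exchange roles for the parameters: now `c zero`, the base of the first inverted
    -- factor, is the one apart from 0 and from all the bᵢ.
    ; parameters = λ t isParameters N → nonzero t (quotient-infinitelyMany c b (1-T t)
        (IsDegreeOne.base#0 (γ-degreeOne zero)) (λ i → #-sym (b#c i zero)) (Q⋆[1-T] t isParameters) N)
    }
    where
    open IsLocallyNormalForm nf
    b : Fin (suc r) → ℂ
    b i = IsDegreeOne.base (β-degreeOne i)
    c : Fin (suc s) → ℂ
    c j = IsDegreeOne.base (γ-degreeOne j)

    b#c : ∀ i j → b i # c j
    b#c i j = #-congʳ (sym (base≈value (β i) (β-degreeOne i)))
      (#-congˡ (sym (base≈value (γ j) (γ-degreeOne j))) (normal i j))

    P⋆α : ∏[1- b X] bell α ≋ ∏[1- c X] ε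
    P⋆α n = begin
      (∏[1- b X] bell α) n
        ≈⟨ ∏[1-X]-cong b (λ k → trans (factored k) (bell-⊛ (⨂ β) (⨂ γ⁻¹) k)) n ⟩
      (∏[1- b X] (bell (⨂ β) ⋆ bell (⨂ γ⁻¹))) n   ≈⟨ ∏[1-X]-⋆ˡ b (bell (⨂ β)) (bell (⨂ γ⁻¹)) n ⟨
      ((∏[1- b X] bell (⨂ β)) ⋆ bell (⨂ γ⁻¹)) n
        ≈⟨ ⋆-cong (∏[1-X]-⨂ β β-degreeOne) (bell-⨂-inverse γ γ⁻¹ γ-degreeOne γ-inverse) n ⟩
      (ε ⋆ (∏[1- c X] ε)) n                         ≈⟨ ⋆-identityˡ (∏[1- c X] ε) n ⟩
      (∏[1- c X] ε) n                               ∎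
      where open ≈

    Q⋆[1-T] : ∀ t → AreParameters p α t → ∏[1- c X] 1-T t ≋ ∏[1- b X] ε
    Q⋆[1-T] t isParameters n = begin
      (∏[1- c X] 1-T t) n                    ≈⟨ ∏[1-X]-cong c (⋆-identityʳ (1-T t)) n ⟨
      (∏[1- c X] (1-T t ⋆ ε)) n              ≈⟨ ∏[1-X]-⋆ʳ c (1-T t) ε n ⟨
      -- With Q rewritten as P A, the factor 1 - T meets A and cancels it, leaving P.
      (1-T t ⋆ (∏[1- c X] ε)) n              ≈⟨ ⋆-cong (λ _ → refl) P⋆α n ⟨
      (1-T t ⋆ (∏[1- b X] bell α)) n        ≈⟨ ∏[1-X]-⋆ʳ b (1-T t) (bell α) n ⟩
      (∏[1- b X] (1-T t ⋆ bell α)) n         ≈⟨ ∏[1-X]-cong b 1-T⋆α n ⟩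
      (∏[1- b X] ε) n                        ∎
      where
      open ≈
      1-T⋆α : 1-T t ⋆ bell α ≋ ε
      1-T⋆α k = trans (⋆-cong (λ _ → refl) (λ i → sym (isParameters i)) k) (1-T⋆F t k)

    -- An index above N is positive, so the constant term 1 of 1 - T is never the coefficient found,
    -- and only a sign has to be removed.
    nonzero : ∀ t {N} → ∃ (λ n → N ℕ.< n × 1-T t n # 0#) → ∃ λ n → N ℕ.< n × t n # 0#
    nonzero t (suc n , N<n , -t#0) = suc n , N<n , -x#0⇒x#0 -t#0

corollary12 : ∀ (p : ℕ) → Prime p → (α : Arithmetic) → IsMultiplicative α →
    ∀ (r s : ℕ) → 1 ≤ r → 1 ≤ s → IsLocallyNormalForm p r s α → IsType4 p α
corollary12 p pp α _ (suc r) (suc s) _ _ nf = mixed⇒type4 pp α nf
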